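{- Let $p$ be a prime, $q$ a power of $p$, and $r$ an odd prime coprime with $q$ such that $q$ is a primitive root modulo $r$. Let $\theta$ be the class of $x$ in $\mathbb{F}_q[x]/(\Phi_r(x)) = \mathbb{F}_{q^{r-1}}$, where $\Phi_r(x)=x^{r-1}+x^{r-2}+\dots+x+1$. Let $e$ be any integer, $f$ any integer coprime with $r$, and $a$ any non-zero element of $\mathbb{F}_q$. Then: (a) the element $\theta^e(\theta^f+a)$ has multiplicative order at least $U(r-2,p-1)$; (b) if $a\neq 1,-1$, then the element $\theta^e(\theta^f+a)$ has multiplicative order at least $\frac{1}{2}\,[U((r-3)/2,p-1)]^2$.
   Context: Since $q$ is a primitive root modulo the prime $r$ (i.e. the multiplicative order of $q$ modulo $r$ is $r-1$), the cyclotomic polynomial $\Phi_r(x)$ is irreducible over $\mathbb{F}_q$, so $\mathbb{F}_q[x]/(\Phi_r(x))$ is the field $\mathbb{F}_{q^{r-1}}$ and $\theta$ satisfies $\theta^r=1$. Multiplicative order means order in the group $\mathbb{F}_{q^{r-1}}^*$. For integers $n\ge 0$ and $d\ge 1$, $U(n,d)$ denotes the number of partitions of $n$ in which every part appears at most $d$ times, i.e. the number of tuples of non-negative integers $(u_1,\dots,u_n)$ with $\sum_{j=1}^n j u_j = n$ and $u_j\le d$ for all $j$. -}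

module Defs where

open import Level using (0ℓ)
open import Algebra.Bundles using (CommutativeRing)
open import Data.Nat as ℕ using (ℕ; zero; suc; _≤_; _∸_; _≟_)
open import Data.Integer as ℤ using (ℤ; +_; -[1+_])
open import Data.List using (List; []; _∷_; length; filter; concatMap; map)
import Data.List
open import Data.Vec using (Vec; []; _∷_)
open import Data.Product using (Σ; _×_)
open import Data.Fin using (Fin)
open import Function.Bundles using (Bijection)
open import Relation.Binary.PropositionalEquality using (_≡_)
import Relation.Binary.PropositionalEquality as P
open import Relation.Nullary using (¬_)

allVecs : (d n : ℕ) → List (Vec ℕ n)
allVecs d zero    = [] ∷ []
allVecs d (suc n) = concatMap (λ u → map (u ∷_) (allVecs d n)) (Data.List.upTo (suc d))

weightedFrom : ℕ → {n : ℕ} → Vec ℕ n → ℕ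
weightedFrom s []       = 0
weightedFrom s (u ∷ us) = s ℕ.* u ℕ.+ weightedFrom (suc s) us

U : (n d : ℕ) → ℕ
U n d = length (filter (λ u → weightedFrom 1 u ≟ n) (allVecs d n))

≡1mod : ℕ → ℕ → Set
≡1mod r n = Σ ℕ λ m → n ≡ 1 ℕ.+ m ℕ.* r

IsPrimitiveRoot : ℕ → ℕ → Set
IsPrimitiveRoot q r =
  ≡1mod r (q ℕ.^ (r ∸ 1)) ×
  ((k : ℕ) → 1 ≤ k → ≡1mod r (q ℕ.^ k) → r ∸ 1 ≤ k)

IsFiniteFieldOfSize : CommutativeRing 0ℓ 0ℓ → ℕ → Set
IsFiniteFieldOfSize F q =
  (¬ (1# ≈ 0#)) ×
  ((x : Carrier) → ¬ (x ≈ 0#) → Σ Carrier λ y → x * y ≈ 1#) ×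
  Bijection setoid (P.setoid (Fin q))
  where open CommutativeRing F

-- Polynomials over F as coefficient lists (index i = coefficient of x^i),
-- and arithmetic in F[x]/(Φ_r(x)).

module Poly (F : CommutativeRing 0ℓ 0ℓ) where
  open CommutativeRing F

  Pol : Set
  Pol = List Carrier

  _≈P_ : Pol → Pol → Set
  []       ≈P []       = Data.Unit.⊤ where import Data.Unit
  []       ≈P (b ∷ bs) = (b ≈ 0#) × ([] ≈P bs)
  (a ∷ as) ≈P []       = (a ≈ 0#) × (as ≈P [])
  (a ∷ as) ≈P (b ∷ bs) = (a ≈ b) × (as ≈P bs)

  _+P_ : Pol → Pol → Pol
  []       +P bs       = bs
  (a ∷ as) +P []       = a ∷ as
  (a ∷ as) +P (b ∷ bs) = (a + b) ∷ (as +P bs)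

  -P_ : Pol → Pol
  -P as = map -_ as

  scale : Carrier → Pol → Pol
  scale c as = map (c *_) as

  _*P_ : Pol → Pol → Pol
  []       *P bs = []
  (a ∷ as) *P bs = scale a bs +P (0# ∷ (as *P bs))

  oneP : Pol
  oneP = 1# ∷ []

  _^P_ : Pol → ℕ → Pol
  p ^P zero  = oneP
  p ^P suc k = p *P (p ^P k)

  xPow : ℕ → Pol
  xPow zero    = oneP
  xPow (suc n) = 0# ∷ xPow n

  Φ : ℕ → Pol
  Φ r = Data.List.replicate r 1#

  _≡_[modΦ_] : Pol → Pol → ℕ → Set
  u ≡ v [modΦ r ] = Σ Pol λ g → (u +P (-P v)) ≈P (Φ r *P g)

  -- θ^e for an integer e, θ = class of x; for negative e we use
  -- θ^{-1} = θ^{r-1} (as θ^r = 1).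
  θ^ : ℕ → ℤ → Pol
  θ^ r (+ n)     = xPow n
  θ^ r -[1+ n ]  = xPow (r ∸ 1) ^P suc n

  elt : ℕ → ℤ → ℤ → Carrier → Pol
  elt r e f a = θ^ r e *P (θ^ r f +P (a ∷ []))

  OrderAtLeast : ℕ → Pol → ℕ → Set
  OrderAtLeast r u N = (k : ℕ) → 1 ≤ k → (u ^P k) ≡ oneP [modΦ r ] → N ≤ k

-- Let θ be the class of x and K = F_q[x]/(Φ_r). Replacing α = θ^e (θ^f + a) by a conjugate α^(q^n) we
-- may take f = 1, so α = θ^w (θ + a). As q is a primitive root modulo r, every θ^(wj) (θ^j + a) with r ∤ j
-- is a power α^(q^n(j)); hence a tuple u gives the power α^(Σ u_j q^n(j)) = θ^(w Σ j u_j) Π (θ^j + a)^(u_j).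
-- For partitions of r - 2 these products are polynomials of degree < r - 1 in θ, so equality in K is
-- equality in F_q[x]. The exponents are then recovered from the lowest index up: after cancelling the
-- factors of index < k, the coefficient of x^k determines u_k modulo p. Thus distinct partitions give distinct
-- exponents modulo the order.
--
-- For (b) the factors θ^(-j) + a are used as well, giving Π (x^j + a)^(u_j) (1 + a x^j)^(v_j). A relation
-- between two such products, raised to the power q^h ≡ -1 (mod r), also holds with u and v exchanged. The
-- coefficients of x^k in both relations determine u_k and v_k unless a² = -1, and then multiplying the two
-- relations and looking at x^(2k) settles the remaining case.
module Submission where

open import Defs
open import Level using (0ℓ)
open import Algebra.Bundles using (CommutativeRing; CommutativeMonoid)
open import Algebra.Structures using (IsCommutativeRing)
open import Data.Nat as ℕ using (ℕ; zero; suc; _≤_; _<_; _∸_; _⊔_; _!; s≤s; z≤n)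
import Data.Nat.Properties as ℕₚ
open import Data.Nat.Combinatorics using (nCn≡1)
open import Data.Nat.Coprimality using (Coprime; prime⇒coprime; coprime-Bézout)
open import Data.Nat.Divisibility using (_∣_; _∤_; _∣?_; divides; ∣-refl; ∣⇒≤; m∣m*n; m%n≡0⇒n∣m)
open import Data.Nat.DivMod using (m≡m%n+[m/n]*n; m%n<n; m/n*n≡m; m/n*n≤m; m/n≤m)
open import Data.Nat.GCD using (module Bézout)
open import Data.Nat.Primality using (Prime; euclidsLemma; prime⇒nonZero; prime⇒nonTrivial; ¬prime[0])
open import Data.Fin as Fin using (Fin; toℕ; inject₁; fromℕ; fromℕ<)
import Data.Fin.Properties as Finₚ
import Data.Fin.Permutation as Perm
open import Data.List as List using (List; []; _∷_; length; map)
open import Data.List.Properties using (length-++; length-map; length-replicate)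
open import Data.List.Membership.Propositional using (_∈_)
open import Data.List.Membership.Propositional.Properties using (∈-lookup; ∈-filter⁻; ∈-upTo⁻; ∈-cartesianProduct⁻; ∈-cartesianProductWith⁻)
open import Data.List.Relation.Unary.All as List-All using ([]; _∷_)
open import Data.List.Relation.Unary.AllPairs using ([]; _∷_)
open import Data.List.Relation.Unary.Any using (here)
open import Data.List.Relation.Unary.Unique.Propositional using (Unique)
import Data.List.Relation.Unary.Unique.Propositional.Properties as Unique
open import Data.Vec using (Vec; []; _∷_)
open import Data.Vec.Functional using (replicate)
open import Data.Vec.Properties using (∷-injective)
open import Data.Vec.Relation.Unary.All as All using (All; []; _∷_)
open import Data.Product using (Σ; ∃; _,_; _×_; proj₁; proj₂)
open import Data.Sum using (inj₁; inj₂)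
open import Function.Base using (_∘_)
open import Function.Bundles using (Bijection)
open import Relation.Binary.Definitions using (tri<; tri≈; tri>)
open import Relation.Binary.PropositionalEquality as ≡ using (_≡_; _≢_)
open import Relation.Nullary using (¬_; contradiction; Dec; yes; no)
open import Relation.Nullary.Decidable using (map′)
import Algebra.Properties.CommutativeMonoid.Sum as CommutativeMonoidSum
import Algebra.Properties.Semiring.Exp as SemiringExp
import Algebra.Properties.Semiring.Mult as SemiringMult
import Algebra.Solver.Ring.NaturalCoefficients.Default as SemiringSolver

-- The bounds come from a pigeonhole count: the residues modulo k are the holes, and exponents that
-- are pairwise distinct modulo k number at most k. All partitions in one count have the same
-- weight, so that the unit θ^(w Σ j u_j) is common to both sides of a relation and cancels whatever
-- w is. In (b) two factors of degree m are multiplied; 2m ≤ r - 2 with r odd leads to m = (r -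
-- 3)/2.
--
-- In the quotient only powers of θ are cancelled, and these are units because θ^r = 1. The factors
-- θ^j + a are cancelled after the passage to F_q[x], where a nonzero constant coefficient suffices.
--
-- The obstacle in (b) is that one relation fixes only u_k + v_k a², one equation for two unknowns.
-- The conjugate relation fixes v_k + u_k a², and the system has determinant (1 - a²)(1 + a²). The
-- first factor is nonzero because a ≠ 1, -1. If the second vanishes, both equations only fix u_k -
-- v_k; the coefficient of x^(2k) then supplies u_k + v_k, and 2 is invertible since otherwise a² =
-- -1 = 1.

module _ where

  -- Prime divisors of binomial coefficients.

  open import Data.Nat.Combinatorics using (_C_; nCk≡n!/k![n-k]!; k![n∸k]!∣n!)

  prime∣! : ∀ {p} → Prime p → ∀ n → p ∣ n ! → p ≤ n
  prime∣! pr zero    p∣1 = contradiction (∣⇒≤ p∣1) (ℕₚ.<⇒≱ (ℕ.nonTrivial⇒n>1 _ {{prime⇒nonTrivial pr}}))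
  prime∣! pr (suc n) p∣ with euclidsLemma (suc n) (n !) pr p∣
  ... | inj₁ p∣n+1 = ∣⇒≤ p∣n+1
  ... | inj₂ p∣n!  = ℕₚ.m≤n⇒m≤1+n (prime∣! pr n p∣n!)

  -- The prime p divides p! = C(p,k) k! (p - k)!, but neither of the two factorials, since k and p -
  -- k are both smaller than p.
  prime∣C : ∀ {p} → Prime p → ∀ k → 0 < k → k < p → p ∣ p C k
  prime∣C {p} pr k 0<k k<p with euclidsLemma (p C k) (k ! ℕ.* (p ∸ k) !) pr p∣product
    where
    instance _ = k ℕₚ.!* (p ∸ k) !≢0
    product≡p! : (p C k) ℕ.* (k ! ℕ.* (p ∸ k) !) ≡ p !
    product≡p! = ≡.trans (≡.cong (ℕ._* (k ! ℕ.* (p ∸ k) !)) (nCk≡n!/k![n-k]! (ℕₚ.<⇒≤ k<p)))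
      (m/n*n≡m (k![n∸k]!∣n! (ℕₚ.<⇒≤ k<p)))
    p∣p! : ∀ p → 0 < p → p ∣ p !
    p∣p! (suc n) _ = m∣m*n (n !)
    p∣product : p ∣ (p C k) ℕ.* (k ! ℕ.* (p ∸ k) !)
    p∣product = ≡.subst (p ∣_) (≡.sym product≡p!) (p∣p! p (ℕₚ.<-trans 0<k k<p))
  ... | inj₁ h = h
  ... | inj₂ h with euclidsLemma (k !) ((p ∸ k) !) pr h
  ...   | inj₁ h′ = contradiction (prime∣! pr k h′) (ℕₚ.<⇒≱ k<p)
  ...   | inj₂ h′ = contradiction (prime∣! pr (p ∸ k) h′) (ℕₚ.<⇒≱ (ℕₚ.∸-monoʳ-< 0<k (ℕₚ.<⇒≤ k<p)))

-- Congruences and powers of a primitive root modulo r.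

module _ where
  open import Data.Nat using (_+_; _*_; _^_; _/_; _%_; NonZero)
  open import Relation.Binary.PropositionalEquality using (refl; sym; trans; cong; cong₂; subst; module ≡-Reasoning)

  infix 4 _≡_[mod_]
  -- Multiples of r are added on both sides, so that congruence of natural numbers needs neither
  -- subtraction nor a comparison of i with j.
  _≡_[mod_] : ℕ → ℕ → ℕ → Set
  i ≡ j [mod r ] = ∃ λ m → ∃ λ n → i + m * r ≡ j + n * r

  %-≡⇒mod : ∀ {i j r} .{{_ : NonZero r}} → i % r ≡ j % r → i ≡ j [mod r ]
  -- Each side is completed by the quotient of the other, so both become the common remainder plus
  -- (i / r + j / r) r.
  %-≡⇒mod {i} {j} {r} eq = j / r , i / r , (begin
    i + (j / r) * r                          ≡⟨ cong (_+ (j / r) * r) (m≡m%n+[m/n]*n i r) ⟩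
    i % r + (i / r) * r + (j / r) * r        ≡⟨ cong (λ x → x + (i / r) * r + (j / r) * r) eq ⟩
    j % r + (i / r) * r + (j / r) * r        ≡⟨ ℕₚ.+-assoc (j % r) _ _ ⟩
    j % r + ((i / r) * r + (j / r) * r)      ≡⟨ cong (j % r +_) (ℕₚ.+-comm ((i / r) * r) _) ⟩
    j % r + ((j / r) * r + (i / r) * r)      ≡⟨ ℕₚ.+-assoc (j % r) _ _ ⟨
    j % r + (j / r) * r + (i / r) * r        ≡⟨ cong (_+ (i / r) * r) (m≡m%n+[m/n]*n j r) ⟨
    j + (i / r) * r                          ∎)
    where open ≡-Reasoning

  %-≡⇒∣∸ : ∀ i j r .{{_ : NonZero r}} → i % r ≡ j % r → r ∣ j ∸ i
  %-≡⇒∣∸ i j r eq = divides (j / r ∸ i / r) (begin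
    j ∸ i                                              ≡⟨ cong₂ _∸_ (m≡m%n+[m/n]*n j r) (m≡m%n+[m/n]*n i r) ⟩
    (j % r + (j / r) * r) ∸ (i % r + (i / r) * r)      ≡⟨ cong (λ x → (j % r + (j / r) * r) ∸ (x + (i / r) * r)) eq ⟩
    (j % r + (j / r) * r) ∸ (j % r + (i / r) * r)      ≡⟨ ℕₚ.[m+n]∸[m+o]≡n∸o (j % r) _ _ ⟩
    (j / r) * r ∸ (i / r) * r                          ≡⟨ ℕₚ.*-distribʳ-∸ r (j / r) (i / r) ⟨
    (j / r ∸ i / r) * r                                ∎)
    where open ≡-Reasoning

  prime∤1 : ∀ {r} → Prime r → r ∤ 1
  prime∤1 r-prime (divides m 1≡mr) =
    contradiction (ℕₚ.m*n≡1⇒n≡1 m _ (sym 1≡mr)) (ℕ.nonTrivial⇒≢1 {{prime⇒nonTrivial r-prime}})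

  coprime⇒∤ : ∀ {m r} → Prime r → Coprime m r → r ∤ m
  coprime⇒∤ r-prime m⊥r r∣m = contradiction (m⊥r (r∣m , ∣-refl)) (ℕ.nonTrivial⇒≢1 {{prime⇒nonTrivial r-prime}})

  prime∤* : ∀ {r m n} → Prime r → r ∤ m → r ∤ n → r ∤ m * n
  prime∤* {m = m} {n} r-prime r∤m r∤n h with euclidsLemma m n r-prime h
  ... | inj₁ k = r∤m k
  ... | inj₂ k = r∤n k

  prime∤^ : ∀ {r m} n → Prime r → r ∤ m → r ∤ m ^ n
  prime∤^ zero    r-prime r∤m = prime∤1 r-prime
  prime∤^ (suc n) r-prime r∤m = prime∤* r-prime r∤m (prime∤^ n r-prime r∤m)

  module PrimitiveRoot {q r′ : ℕ} (r-prime : Prime (suc r′)) (q⊥r : Coprime q (suc r′))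
                       (q-primitive : IsPrimitiveRoot q (suc r′)) where
    private
      r : ℕ
      r = suc r′

    r∤q : r ∤ q
    r∤q = coprime⇒∤ r-prime q⊥r

    private instance
      q-nonZero : NonZero q
      q-nonZero = ℕ.≢-nonZero λ { refl → r∤q (divides 0 refl) }

    %-nonZero : ∀ {x} → r ∤ x → NonZero (x % r)
    %-nonZero {x} r∤x = ℕ.≢-nonZero λ eq → r∤x (m%n≡0⇒n∣m x r eq)

    pred-% : ∀ {x} → r ∤ x → ℕ.pred (x % r) < r′
    pred-% {x} r∤x = ℕ.s≤s⁻¹ (subst (_< r) (sym (ℕₚ.suc-pred (x % r) {{%-nonZero r∤x}})) (m%n<n x r))

    -- The nonzero residues 1, ..., r - 1 shifted down by one, so that there are exactly r - 1 holes
    -- for the pigeonhole argument.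
    residue : ∀ x → r ∤ x → Fin r′
    residue x r∤x = fromℕ< (pred-% r∤x)

    residue-injective : ∀ x y (r∤x : r ∤ x) (r∤y : r ∤ y) → residue x r∤x ≡ residue y r∤y → x % r ≡ y % r
    residue-injective x y r∤x r∤y h = ℕₚ.pred-injective {{%-nonZero r∤x}} {{%-nonZero r∤y}}
      (Finₚ.fromℕ<-injective _ _ (pred-% r∤x) (pred-% r∤y) h)

    multiple∤ : ∀ {c} → r ∤ c → ∀ i → r ∤ c * q ^ i
    multiple∤ r∤c i = prime∤* r-prime r∤c (prime∤^ i r-prime r∤q)

    -- The difference is c q^i (q^(j-i) - 1). The prime r does not divide c q^i, and r dividing the
    -- last factor would make j - i at least r - 1 by primitivity.
    multiples-distinct : ∀ {c i j} → r ∤ c → i < j → j < r′ → (c * q ^ i) % r ≢ (c * q ^ j) % r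
    multiples-distinct {c} {i} {j} r∤c i<j j<r′ h with r ∣? (q ^ (j ∸ i) ∸ 1)
    ... | no r∤ = prime∤* r-prime (multiple∤ r∤c i) r∤
      (subst (r ∣_) factored (%-≡⇒∣∸ (c * q ^ i) (c * q ^ j) r h))
      where
      open ≡-Reasoning
      factored : c * q ^ j ∸ c * q ^ i ≡ (c * q ^ i) * (q ^ (j ∸ i) ∸ 1)
      factored = begin
        c * q ^ j ∸ c * q ^ i                                ≡⟨ cong (λ n → c * q ^ n ∸ c * q ^ i) (ℕₚ.m+[n∸m]≡n (ℕₚ.<⇒≤ i<j)) ⟨
        c * q ^ (i + (j ∸ i)) ∸ c * q ^ i                    ≡⟨ cong (λ x → c * x ∸ c * q ^ i) (ℕₚ.^-distribˡ-+-* q i (j ∸ i)) ⟩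
        c * (q ^ i * q ^ (j ∸ i)) ∸ c * q ^ i                ≡⟨ cong₂ _∸_ (ℕₚ.*-assoc c (q ^ i) (q ^ (j ∸ i))) (ℕₚ.*-identityʳ (c * q ^ i)) ⟨
        (c * q ^ i) * q ^ (j ∸ i) ∸ (c * q ^ i) * 1          ≡⟨ ℕₚ.*-distribˡ-∸ (c * q ^ i) (q ^ (j ∸ i)) 1 ⟨
        (c * q ^ i) * (q ^ (j ∸ i) ∸ 1)                      ∎
    ... | yes (divides m eq) = ℕₚ.<⇒≱ (ℕₚ.≤-<-trans (ℕₚ.m∸n≤m j i) j<r′)
      (proj₂ q-primitive (j ∸ i) (ℕₚ.m<n⇒0<n∸m i<j)
        (m , trans (sym (ℕₚ.m+[n∸m]≡n (ℕₚ.m^n>0 q (j ∸ i)))) (cong suc eq)))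

    -- The r numbers d, c, c q, ..., c q^(r-2) fall into r - 1 nonzero classes. The multiples of c
    -- are pairwise incongruent, so the collision involves d.
    power-multiple : ∀ {c d} → r ∤ c → r ∤ d → ∃ λ n → c * q ^ n ≡ d [mod r ]
    power-multiple {c} {d} r∤c r∤d with Finₚ.pigeonhole (ℕₚ.n<1+n r′) holes
      where
      holes : Fin r → Fin r′
      holes Fin.zero    = residue d r∤d
      holes (Fin.suc i) = residue (c * q ^ toℕ i) (multiple∤ r∤c (toℕ i))
    ... | Fin.zero  , Fin.suc j , _       , eq = toℕ j , %-≡⇒mod (sym (residue-injective d (c * q ^ toℕ j) r∤d (multiple∤ r∤c (toℕ j)) eq))
    ... | Fin.suc i , Fin.suc j , s≤s i<j , eq = contradiction
      (residue-injective (c * q ^ toℕ i) (c * q ^ toℕ j) (multiple∤ r∤c (toℕ i)) (multiple∤ r∤c (toℕ j)) eq) (multiples-distinct r∤c i<j (Finₚ.toℕ<n j))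

    -- The discrete logarithm to base q modulo r. The value 0 at multiples of r is a default that
    -- makes it total, so that exponents can be formed without divisibility proofs.
    log : ℕ → ℕ
    log j with r ∣? j
    ... | yes _ = 0
    ... | no r∤j′ = proj₁ (power-multiple (prime∤1 r-prime) r∤j′)

    q^log : ∀ {j} → r ∤ j → q ^ log j ≡ j [mod r ]
    q^log {j} r∤j with r ∣? j
    ... | yes r∣j = contradiction r∣j r∤j
    ... | no r∤j′ with power-multiple (prime∤1 r-prime) r∤j′
    ...   | n , a , b , eq = a , b , trans (cong (_+ a * r) (sym (ℕₚ.*-identityˡ (q ^ n)))) eq

-- Counting partitions by injections into finite sets.

module _ where
  open import Data.List using (List; []; _∷_; length; map; _++_; concatMap; filter; upTo; cartesianProduct; cartesianProductWith)
  open import Relation.Binary.PropositionalEquality using (refl; sym; trans; cong; cong₂; subst)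

  lookup-injective : ∀ {A : Set} {xs : List A} → Unique xs → ∀ i j → List.lookup xs i ≡ List.lookup xs j → i ≡ j
  lookup-injective {xs = _ ∷ _} _        Fin.zero    Fin.zero    _ = refl
  lookup-injective {xs = _ ∷ _} (x∉ ∷ _) Fin.zero    (Fin.suc j) h = contradiction h (List-All.lookup x∉ (∈-lookup j))
  lookup-injective (x∉ ∷ _) (Fin.suc i) Fin.zero    h = contradiction (sym h) (List-All.lookup x∉ (∈-lookup i))
  lookup-injective (_ ∷ u)  (Fin.suc i) (Fin.suc j) h = cong Fin.suc (lookup-injective u i j h)

  length-injection : ∀ {A : Set} {k} {xs : List A} → Unique xs → (f : A → Fin k) →
    (∀ {x y} → x ∈ xs → y ∈ xs → f x ≡ f y → x ≡ y) → length xs ≤ k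
  length-injection {xs = xs} unique f f-injective = Finₚ.injective⇒≤ {f = λ i → f (List.lookup xs i)}
    λ {i} {j} h → lookup-injective unique i j (f-injective (∈-lookup i) (∈-lookup j) h)

  -- Recognises the recursion of `allVecs` as a cartesian product, from which uniqueness and the
  -- bound on the entries are read off.
  concatMap-map : ∀ {A B C : Set} (f : A → B → C) xs ys →
    concatMap (λ x → map (f x) ys) xs ≡ cartesianProductWith f xs ys
  concatMap-map f []       ys = refl
  concatMap-map f (x ∷ xs) ys = cong (map (f x) ys ++_) (concatMap-map f xs ys)

  length-cartesianProduct : ∀ {A B : Set} (xs : List A) (ys : List B) →
    length (cartesianProduct xs ys) ≡ length xs ℕ.* length ys
  length-cartesianProduct []       ys = refl
  length-cartesianProduct (x ∷ xs) ys = trans (length-++ (map (x ,_) ys))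
    (cong₂ ℕ._+_ (length-map (x ,_) ys) (length-cartesianProduct xs ys))

  allVecs-unique : ∀ d n → Unique (allVecs d n)
  allVecs-unique d zero    = [] ∷ []
  allVecs-unique d (suc n) rewrite concatMap-map {C = Vec ℕ (suc n)} _∷_ (upTo (suc d)) (allVecs d n) =
    Unique.cartesianProductWith⁺ _∷_ ∷-injective (Unique.upTo⁺ (suc d)) (allVecs-unique d n)

  allVecs-bounded : ∀ d n {u} → u ∈ allVecs d n → All (_≤ d) u
  allVecs-bounded d zero    (here refl) = []
  allVecs-bounded d (suc n) u∈ rewrite concatMap-map {C = Vec ℕ (suc n)} _∷_ (upTo (suc d)) (allVecs d n)
    with ∈-cartesianProductWith⁻ _∷_ (upTo (suc d)) (allVecs d n) u∈
  ... | _ , _ , x∈ , v∈ , refl = ℕ.s≤s⁻¹ (∈-upTo⁻ x∈) ∷ allVecs-bounded d n v∈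

  IsPartition : (n d : ℕ) → Vec ℕ n → Set
  IsPartition n d u = weightedFrom 1 u ≡ n × All (_≤ d) u

  module _ {n d k : ℕ} where
    private
      hasWeight = λ (u : Vec ℕ n) → weightedFrom 1 u ℕ.≟ n
      partitions = filter hasWeight (allVecs d n)

      partitions-unique : Unique partitions
      partitions-unique = Unique.filter⁺ hasWeight (allVecs-unique d n)

    private
      ∈⇒isPartition : ∀ {u} → u ∈ partitions → IsPartition n d u
      ∈⇒isPartition u∈ with ∈-filter⁻ hasWeight {xs = allVecs d n} u∈
      ... | u∈all , weight = weight , allVecs-bounded d n u∈all

    -- Here k will be an exponent that kills the given element, and f the residue modulo k of the
    -- exponent attached to a partition.
    U≤ : (f : Vec ℕ n → Fin k) →
      (∀ {u v} → IsPartition n d u → IsPartition n d v → f u ≡ f v → u ≡ v) → U n d ≤ k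
    U≤ f f-injective = length-injection partitions-unique f
      λ u∈ v∈ → f-injective (∈⇒isPartition u∈) (∈⇒isPartition v∈)

    U*U≤ : (f : Vec ℕ n → Vec ℕ n → Fin k) →
      (∀ {u v u′ v′} → IsPartition n d u → IsPartition n d v → IsPartition n d u′ → IsPartition n d v′ →
        f u v ≡ f u′ v′ → u ≡ u′ × v ≡ v′) →
      U n d ℕ.* U n d ≤ k
    U*U≤ f f-injective = subst (_≤ k) (length-cartesianProduct partitions partitions)
      (length-injection (Unique.cartesianProduct⁺ partitions-unique partitions-unique) (λ (u , v) → f u v)
        λ {(u , v)} {(u′ , v′)} x∈ y∈ eq → pair-eq x∈ y∈ eq)
      where
      pair-eq : ∀ {u v u′ v′} → (u , v) ∈ cartesianProduct partitions partitions →
        (u′ , v′) ∈ cartesianProduct partitions partitions → f u v ≡ f u′ v′ → (u , v) ≡ (u′ , v′)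
      pair-eq x∈ y∈ eq with ∈-cartesianProduct⁻ partitions partitions x∈ | ∈-cartesianProduct⁻ partitions partitions y∈
      ... | u∈ , v∈ | u′∈ , v′∈ with f-injective (∈⇒isPartition u∈) (∈⇒isPartition v∈) (∈⇒isPartition u′∈) (∈⇒isPartition v′∈) eq
      ...   | u≡u′ , v≡v′ = cong₂ _,_ u≡u′ v≡v′

-- The commutative ring F[x] on coefficient lists.

module PolynomialRing (F : CommutativeRing 0ℓ 0ℓ) where
  open CommutativeRing F
  open Poly F
  open import Algebra.Properties.Ring ring using (-0#≈0#)
  open import Relation.Binary.Reasoning.Setoid setoid
  open SemiringSolver commutativeSemiring using (solve; _:+_; _:*_; _:=_)

  coeff : Pol → ℕ → Carrier
  coeff []       _       = 0#
  coeff (a ∷ _)  zero    = a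
  coeff (_ ∷ as) (suc n) = coeff as n

  infix 4 _≋_
  -- Coefficients beyond the end of a list count as 0, so lists that differ by trailing zeros are
  -- equal and no case distinction on lengths is needed. As a record it lets both sides be inferred.
  record _≋_ (p q : Pol) : Set where
    constructor pointwise
    field at : ∀ n → coeff p n ≈ coeff q n
  open _≋_ public

  ≈P⇒≋ : ∀ p q → p ≈P q → p ≋ q
  ≈P⇒≋ p q h = pointwise (go p q h)
    where
    go : ∀ p q → p ≈P q → ∀ n → coeff p n ≈ coeff q n
    go []       []       _       _       = refl
    go []       (b ∷ bs) (h , _) zero    = sym h
    go []       (b ∷ bs) (_ , h) (suc n) = go [] bs h n
    go (a ∷ as) []       (h , _) zero    = h
    go (a ∷ as) []       (_ , h) (suc n) = go as [] h n
    go (a ∷ as) (b ∷ bs) (h , _) zero    = h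
    go (a ∷ as) (b ∷ bs) (_ , h) (suc n) = go as bs h n

  coeff-+ : ∀ p q n → coeff (p +P q) n ≈ coeff p n + coeff q n
  coeff-+ []       q        n       = sym (+-identityˡ _)
  coeff-+ (a ∷ as) []       n       = sym (+-identityʳ _)
  coeff-+ (a ∷ as) (b ∷ bs) zero    = refl
  coeff-+ (a ∷ as) (b ∷ bs) (suc n) = coeff-+ as bs n

  coeff-neg : ∀ p n → coeff (-P p) n ≈ - coeff p n
  coeff-neg []       n       = sym -0#≈0#
  coeff-neg (a ∷ as) zero    = refl
  coeff-neg (a ∷ as) (suc n) = coeff-neg as n

  coeff-scale : ∀ c p n → coeff (scale c p) n ≈ c * coeff p n
  coeff-scale c []       n       = sym (zeroʳ c)
  coeff-scale c (a ∷ as) zero    = refl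
  coeff-scale c (a ∷ as) (suc n) = coeff-scale c as n

  coeff-*-zero : ∀ a as q → coeff ((a ∷ as) *P q) 0 ≈ a * coeff q 0
  coeff-*-zero a as q = begin
    coeff ((a ∷ as) *P q) 0    ≈⟨ coeff-+ (scale a q) _ 0 ⟩
    coeff (scale a q) 0 + 0#   ≈⟨ +-identityʳ _ ⟩
    coeff (scale a q) 0        ≈⟨ coeff-scale a q 0 ⟩
    a * coeff q 0              ∎

  coeff-*-suc : ∀ a as q n → coeff ((a ∷ as) *P q) (suc n) ≈ a * coeff q (suc n) + coeff (as *P q) n
  coeff-*-suc a as q n = begin
    coeff ((a ∷ as) *P q) (suc n)                    ≈⟨ coeff-+ (scale a q) _ (suc n) ⟩
    coeff (scale a q) (suc n) + coeff (as *P q) n    ≈⟨ +-congʳ (coeff-scale a q (suc n)) ⟩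
    a * coeff q (suc n) + coeff (as *P q) n          ∎

  ≋-refl : ∀ {p} → p ≋ p
  ≋-refl = pointwise λ _ → refl

  ≋-sym : ∀ {p q} → p ≋ q → q ≋ p
  ≋-sym h = pointwise λ n → sym (at h n)

  ≋-trans : ∀ {p q s} → p ≋ q → q ≋ s → p ≋ s
  ≋-trans h k = pointwise λ n → trans (at h n) (at k n)

  +P-cong : ∀ {p p′ q q′} → p ≋ p′ → q ≋ q′ → p +P q ≋ p′ +P q′
  +P-cong {p} {p′} {q} {q′} h k = pointwise λ n →
    trans (coeff-+ p q n) (trans (+-cong (at h n) (at k n)) (sym (coeff-+ p′ q′ n)))

  +P-assoc : ∀ p q s → (p +P q) +P s ≋ p +P (q +P s)
  +P-assoc p q s = pointwise λ n → begin
    coeff ((p +P q) +P s) n                ≈⟨ coeff-+ (p +P q) s n ⟩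
    coeff (p +P q) n + coeff s n           ≈⟨ +-congʳ (coeff-+ p q n) ⟩
    (coeff p n + coeff q n) + coeff s n    ≈⟨ +-assoc _ _ _ ⟩
    coeff p n + (coeff q n + coeff s n)    ≈⟨ +-congˡ (coeff-+ q s n) ⟨
    coeff p n + coeff (q +P s) n           ≈⟨ coeff-+ p (q +P s) n ⟨
    coeff (p +P (q +P s)) n                ∎

  +P-comm : ∀ p q → p +P q ≋ q +P p
  +P-comm p q = pointwise λ n →
    trans (coeff-+ p q n) (trans (+-comm _ _) (sym (coeff-+ q p n)))

  +P-identityʳ : ∀ p → p +P [] ≋ p
  +P-identityʳ p = +P-comm p []

  -P-cong : ∀ {p q} → p ≋ q → -P p ≋ -P q
  -P-cong {p} {q} h = pointwise λ n →
    trans (coeff-neg p n) (trans (-‿cong (at h n)) (sym (coeff-neg q n)))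

  -P-inverseʳ : ∀ p → p +P (-P p) ≋ []
  -P-inverseʳ p = pointwise λ n → begin
    coeff (p +P (-P p)) n          ≈⟨ coeff-+ p (-P p) n ⟩
    coeff p n + coeff (-P p) n     ≈⟨ +-congˡ (coeff-neg p n) ⟩
    coeff p n + - coeff p n        ≈⟨ -‿inverseʳ _ ⟩
    0#                             ∎

  -P-inverseˡ : ∀ p → (-P p) +P p ≋ []
  -P-inverseˡ p = ≋-trans (+P-comm (-P p) p) (-P-inverseʳ p)

  *P-zeroʳ : ∀ p → p *P [] ≋ []
  *P-zeroʳ p = pointwise (go p)
    where
    go : ∀ p n → coeff (p *P []) n ≈ 0#
    go []       n       = refl
    go (a ∷ as) zero    = refl
    go (a ∷ as) (suc n) = go as n

  *P-congˡ : ∀ p {q q′} → q ≋ q′ → p *P q ≋ p *P q′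
  *P-congˡ p {q} {q′} h = pointwise (go p)
    where
    go : ∀ p n → coeff (p *P q) n ≈ coeff (p *P q′) n
    go []       n       = refl
    go (a ∷ as) zero    = trans (coeff-*-zero a as q)
      (trans (*-congˡ (at h 0)) (sym (coeff-*-zero a as q′)))
    go (a ∷ as) (suc n) = trans (coeff-*-suc a as q n)
      (trans (+-cong (*-congˡ (at h (suc n))) (go as n)) (sym (coeff-*-suc a as q′ n)))

  -- The product is defined by recursion on its left factor; this is the mirror recursion on the
  -- right factor, and commutativity follows by comparing the two.
  *P-∷ʳ : ∀ p b bs → p *P (b ∷ bs) ≋ scale b p +P (0# ∷ (p *P bs))
  *P-∷ʳ p b bs = pointwise λ n → trans (go p n) (sym (coeff-+ (scale b p) _ n))
    where
    go : ∀ p n → coeff (p *P (b ∷ bs)) n ≈ coeff (scale b p) n + coeff (0# ∷ (p *P bs)) n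
    go []       zero    = sym (+-identityʳ _)
    go []       (suc n) = sym (+-identityʳ _)
    go (a ∷ as) zero    = trans (coeff-*-zero a as (b ∷ bs)) (trans (*-comm a b) (sym (+-identityʳ _)))
    go (a ∷ as) (suc zero) = begin
      coeff ((a ∷ as) *P (b ∷ bs)) 1                                ≈⟨ coeff-*-suc a as (b ∷ bs) 0 ⟩
      a * coeff bs 0 + coeff (as *P (b ∷ bs)) 0                     ≈⟨ +-congˡ (go as 0) ⟩
      a * coeff bs 0 + (coeff (scale b as) 0 + 0#)                  ≈⟨ solve 3 (λ x y z → x :+ (y :+ z) := y :+ (x :+ z)) refl _ _ _ ⟩
      coeff (scale b as) 0 + (a * coeff bs 0 + 0#)                  ≈⟨ +-congˡ (+-identityʳ _) ⟩
      coeff (scale b as) 0 + a * coeff bs 0                         ≈⟨ +-congˡ (coeff-*-zero a as bs) ⟨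
      coeff (scale b as) 0 + coeff ((a ∷ as) *P bs) 0               ∎
    go (a ∷ as) (suc (suc n)) = begin
      coeff ((a ∷ as) *P (b ∷ bs)) (suc (suc n))                                ≈⟨ coeff-*-suc a as (b ∷ bs) (suc n) ⟩
      a * coeff bs (suc n) + coeff (as *P (b ∷ bs)) (suc n)                     ≈⟨ +-congˡ (go as (suc n)) ⟩
      a * coeff bs (suc n) + (coeff (scale b as) (suc n) + coeff (as *P bs) n)  ≈⟨ solve 3 (λ x y z → x :+ (y :+ z) := y :+ (x :+ z)) refl _ _ _ ⟩
      coeff (scale b as) (suc n) + (a * coeff bs (suc n) + coeff (as *P bs) n)  ≈⟨ +-congˡ (coeff-*-suc a as bs n) ⟨
      coeff (scale b as) (suc n) + coeff ((a ∷ as) *P bs) (suc n)               ∎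

  ∷-cong : ∀ {a b p q} → a ≈ b → p ≋ q → a ∷ p ≋ b ∷ q
  ∷-cong h k = pointwise λ { zero → h ; (suc n) → at k n }

  *P-comm : ∀ p q → p *P q ≋ q *P p
  *P-comm []       q = ≋-sym (*P-zeroʳ q)
  *P-comm (a ∷ as) q =
    ≋-trans (+P-cong (≋-refl {scale a q}) (∷-cong refl (*P-comm as q))) (≋-sym (*P-∷ʳ q a as))

  *P-cong : ∀ {p p′ q q′} → p ≋ p′ → q ≋ q′ → p *P q ≋ p′ *P q′
  *P-cong {p} {p′} {q} {q′} h k =
    ≋-trans (*P-congˡ p k) (≋-trans (*P-comm p q′) (≋-trans (*P-congˡ q′ h) (*P-comm q′ p′)))

  *P-distribˡ : ∀ p q s → p *P (q +P s) ≋ (p *P q) +P (p *P s)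
  *P-distribˡ p q s = pointwise λ n → trans (go p n) (sym (coeff-+ (p *P q) (p *P s) n))
    where
    go : ∀ p n → coeff (p *P (q +P s)) n ≈ coeff (p *P q) n + coeff (p *P s) n
    go []       n       = sym (+-identityʳ _)
    go (a ∷ as) zero    = begin
      coeff ((a ∷ as) *P (q +P s)) 0                          ≈⟨ coeff-*-zero a as (q +P s) ⟩
      a * coeff (q +P s) 0                                    ≈⟨ *-congˡ (coeff-+ q s 0) ⟩
      a * (coeff q 0 + coeff s 0)                             ≈⟨ distribˡ _ _ _ ⟩
      a * coeff q 0 + a * coeff s 0                           ≈⟨ +-cong (coeff-*-zero a as q) (coeff-*-zero a as s) ⟨
      coeff ((a ∷ as) *P q) 0 + coeff ((a ∷ as) *P s) 0       ∎
    go (a ∷ as) (suc n) = begin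
      coeff ((a ∷ as) *P (q +P s)) (suc n)
        ≈⟨ coeff-*-suc a as (q +P s) n ⟩
      a * coeff (q +P s) (suc n) + coeff (as *P (q +P s)) n
        ≈⟨ +-cong (*-congˡ (coeff-+ q s (suc n))) (go as n) ⟩
      a * (coeff q (suc n) + coeff s (suc n)) + (coeff (as *P q) n + coeff (as *P s) n)
        ≈⟨ solve 5 (λ a x y z w → a :* (x :+ y) :+ (z :+ w) := (a :* x :+ z) :+ (a :* y :+ w)) refl a _ _ _ _ ⟩
      (a * coeff q (suc n) + coeff (as *P q) n) + (a * coeff s (suc n) + coeff (as *P s) n)
        ≈⟨ +-cong (coeff-*-suc a as q n) (coeff-*-suc a as s n) ⟨
      coeff ((a ∷ as) *P q) (suc n) + coeff ((a ∷ as) *P s) (suc n) ∎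

  *P-distribʳ : ∀ p q s → (q +P s) *P p ≋ (q *P p) +P (s *P p)
  *P-distribʳ p q s = ≋-trans (*P-comm (q +P s) p)
    (≋-trans (*P-distribˡ p q s) (+P-cong (*P-comm p q) (*P-comm p s)))

  scale-*P : ∀ c p q → scale c p *P q ≋ scale c (p *P q)
  scale-*P c p q = pointwise λ n → trans (go p n) (sym (coeff-scale c (p *P q) n))
    where
    go : ∀ p n → coeff (scale c p *P q) n ≈ c * coeff (p *P q) n
    go []       n       = sym (zeroʳ c)
    go (a ∷ as) zero    = begin
      coeff (scale c (a ∷ as) *P q) 0  ≈⟨ coeff-*-zero (c * a) (scale c as) q ⟩
      (c * a) * coeff q 0              ≈⟨ *-assoc c a _ ⟩
      c * (a * coeff q 0)              ≈⟨ *-congˡ (coeff-*-zero a as q) ⟨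
      c * coeff ((a ∷ as) *P q) 0      ∎
    go (a ∷ as) (suc n) = begin
      coeff (scale c (a ∷ as) *P q) (suc n)                    ≈⟨ coeff-*-suc (c * a) (scale c as) q n ⟩
      (c * a) * coeff q (suc n) + coeff (scale c as *P q) n    ≈⟨ +-congˡ (go as n) ⟩
      (c * a) * coeff q (suc n) + c * coeff (as *P q) n        ≈⟨ solve 4 (λ c a x y → (c :* a) :* x :+ c :* y := c :* (a :* x :+ y)) refl c a _ _ ⟩
      c * (a * coeff q (suc n) + coeff (as *P q) n)            ≈⟨ *-congˡ (coeff-*-suc a as q n) ⟨
      c * coeff ((a ∷ as) *P q) (suc n)                        ∎

  shift-*P : ∀ p q → (0# ∷ p) *P q ≋ 0# ∷ (p *P q)
  shift-*P p q = pointwise λ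
    { zero    → trans (coeff-*-zero 0# p q) (zeroˡ _)
    ; (suc n) → trans (coeff-*-suc 0# p q n) (trans (+-congʳ (zeroˡ _)) (+-identityˡ _)) }

  *P-assoc : ∀ p q s → (p *P q) *P s ≋ p *P (q *P s)
  *P-assoc []       q s = ≋-refl
  *P-assoc (a ∷ as) q s =
    ≋-trans (*P-distribʳ s (scale a q) (0# ∷ (as *P q)))
      (+P-cong (scale-*P a q s)
        (≋-trans (shift-*P (as *P q) s) (∷-cong refl (*P-assoc as q s))))

  coeff-const : ∀ c p n → coeff ((c ∷ []) *P p) n ≈ c * coeff p n
  coeff-const c p zero    = coeff-*-zero c [] p
  coeff-const c p (suc n) = trans (coeff-*-suc c [] p n) (+-identityʳ _)

  *P-identityˡ : ∀ p → oneP *P p ≋ p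
  *P-identityˡ p = pointwise λ n → trans (coeff-const 1# p n) (*-identityˡ _)

  isCommutativeRingP : IsCommutativeRing _≋_ _+P_ _*P_ -P_ [] oneP
  isCommutativeRingP = record
    { isRing = record
      { +-isAbelianGroup = record
        { isGroup = record
          { isMonoid = record
            { isSemigroup = record
              { isMagma = record
                { isEquivalence = record { refl = ≋-refl ; sym = ≋-sym ; trans = ≋-trans }
                ; ∙-cong = +P-cong }
              ; assoc = +P-assoc }
            ; identity = (λ _ → ≋-refl) , +P-identityʳ }
          ; inverse = -P-inverseˡ , -P-inverseʳ
          ; ⁻¹-cong = -P-cong }
        ; comm = +P-comm }
      ; *-cong = *P-cong
      ; *-assoc = *P-assoc
      ; *-identity = *P-identityˡ , λ p → ≋-trans (*P-comm p oneP) (*P-identityˡ p)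
      ; distrib = *P-distribˡ , *P-distribʳ }
    ; *-comm = *P-comm }

  F[x] : CommutativeRing 0ℓ 0ℓ
  F[x] = record { isCommutativeRing = isCommutativeRingP }

-- The quotient of a commutative ring by a principal ideal.

module Quotient (R : CommutativeRing 0ℓ 0ℓ) (φ : CommutativeRing.Carrier R) where
  open CommutativeRing R
  open import Algebra.Properties.Ring ring using (-‿distribʳ-*)
  open import Algebra.Properties.AbelianGroup +-abelianGroup using (⁻¹-∙-comm)
  open import Relation.Binary.Reasoning.Setoid setoid
  open SemiringSolver commutativeSemiring using (solve; _:+_; _:*_; _:=_)

  infix 4 _~_
  -- Only the equality changes: elements of the quotient are elements of R, so every identity of R
  -- passes down by `≈⇒~`.
  record _~_ (x y : Carrier) : Set where
    constructor differBy
    field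
      quotient : Carrier
      equality : x ≈ y + φ * quotient

  ≈⇒~ : ∀ {x y} → x ≈ y → x ~ y
  ≈⇒~ {x} {y} h = differBy 0# (trans h (sym (trans (+-congˡ (zeroʳ φ)) (+-identityʳ y))))

  ~-sym : ∀ {x y} → x ~ y → y ~ x
  ~-sym {x} {y} (differBy g h) = differBy (- g) (begin
    y                         ≈⟨ +-identityʳ y ⟨
    y + 0#                    ≈⟨ +-congˡ (-‿inverseʳ (φ * g)) ⟨
    y + (φ * g + - (φ * g))   ≈⟨ +-assoc _ _ _ ⟨
    (y + φ * g) + - (φ * g)   ≈⟨ +-cong (sym h) (-‿distribʳ-* φ g) ⟩
    x + φ * - g               ∎)

  ~-trans : ∀ {x y z} → x ~ y → y ~ z → x ~ z
  ~-trans {x} {y} {z} (differBy g h) (differBy g′ h′) = differBy (g + g′) (begin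
    x                       ≈⟨ h ⟩
    y + φ * g               ≈⟨ +-congʳ h′ ⟩
    (z + φ * g′) + φ * g    ≈⟨ solve 4 (λ z φ g g′ → (z :+ φ :* g′) :+ φ :* g := z :+ φ :* (g :+ g′)) refl z φ g g′ ⟩
    z + φ * (g + g′)        ∎)

  ~-+-cong : ∀ {x x′ y y′} → x ~ x′ → y ~ y′ → x + y ~ x′ + y′
  ~-+-cong {x} {x′} {y} {y′} (differBy g h) (differBy g′ h′) = differBy (g + g′) (begin
    x + y                             ≈⟨ +-cong h h′ ⟩
    (x′ + φ * g) + (y′ + φ * g′)      ≈⟨ solve 5 (λ x y φ g g′ → (x :+ φ :* g) :+ (y :+ φ :* g′) := (x :+ y) :+ φ :* (g :+ g′)) refl x′ y′ φ g g′ ⟩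
    (x′ + y′) + φ * (g + g′)          ∎)

  ~-*-cong : ∀ {x x′ y y′} → x ~ x′ → y ~ y′ → x * y ~ x′ * y′
  ~-*-cong {x} {x′} {y} {y′} (differBy g h) (differBy g′ h′) = differBy (g * y′ + x′ * g′ + φ * g * g′) (begin
    x * y                             ≈⟨ *-cong h h′ ⟩
    (x′ + φ * g) * (y′ + φ * g′)
      ≈⟨ solve 5 (λ x y φ g g′ → (x :+ φ :* g) :* (y :+ φ :* g′) := x :* y :+ φ :* (g :* y :+ x :* g′ :+ φ :* g :* g′)) refl x′ y′ φ g g′ ⟩
    x′ * y′ + φ * (g * y′ + x′ * g′ + φ * g * g′) ∎)

  ~-neg-cong : ∀ {x y} → x ~ y → - x ~ - y
  ~-neg-cong {x} {y} (differBy g h) = differBy (- g) (begin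
    - x                   ≈⟨ -‿cong h ⟩
    - (y + φ * g)         ≈⟨ ⁻¹-∙-comm y (φ * g) ⟨
    - y + - (φ * g)       ≈⟨ +-congˡ (-‿distribʳ-* φ g) ⟩
    - y + φ * - g         ∎)

  isCommutativeRing/ : IsCommutativeRing _~_ _+_ _*_ -_ 0# 1#
  isCommutativeRing/ = record
    { isRing = record
      { +-isAbelianGroup = record
        { isGroup = record
          { isMonoid = record
            { isSemigroup = record
              { isMagma = record
                { isEquivalence = record { refl = ≈⇒~ refl ; sym = ~-sym ; trans = ~-trans }
                ; ∙-cong = ~-+-cong }
              ; assoc = λ x y z → ≈⇒~ (+-assoc x y z) }
            ; identity = (λ x → ≈⇒~ (+-identityˡ x)) , λ x → ≈⇒~ (+-identityʳ x) }
          ; inverse = (λ x → ≈⇒~ (-‿inverseˡ x)) , λ x → ≈⇒~ (-‿inverseʳ x)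
          ; ⁻¹-cong = ~-neg-cong }
        ; comm = λ x y → ≈⇒~ (+-comm x y) }
      ; *-cong = ~-*-cong
      ; *-assoc = λ x y z → ≈⇒~ (*-assoc x y z)
      ; *-identity = (λ x → ≈⇒~ (*-identityˡ x)) , λ x → ≈⇒~ (*-identityʳ x)
      ; distrib = (λ x y z → ≈⇒~ (distribˡ x y z)) , λ x y z → ≈⇒~ (distribʳ x y z) }
    ; *-comm = λ x y → ≈⇒~ (*-comm x y) }

  R/φ : CommutativeRing 0ℓ 0ℓ
  R/φ = record { isCommutativeRing = isCommutativeRing/ }

-- The Frobenius map in characteristic p.

CharacteristicDivides : CommutativeRing 0ℓ 0ℓ → ℕ → Set
CharacteristicDivides R p = p · 1# ≈ 0#
  where
  open CommutativeRing R
  open SemiringMult semiring renaming (_×_ to _·_)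

module Frobenius (R : CommutativeRing 0ℓ 0ℓ) {p : ℕ} (p-prime : Prime p) (p·1≈0 : CharacteristicDivides R p) where
  open CommutativeRing R
  open SemiringMult semiring using () renaming (_×_ to _·_)
  open import Algebra.Properties.CommutativeSemiring.Exp commutativeSemiring
  open SemiringMult semiring using (×-assocˡ; ×-assoc-*; ×-congʳ; ×-homo-1; ×-congˡ)
  open import Algebra.Properties.Semiring.Sum semiring using (sum; sum-init-last; sum-cong-≋; sum-replicate-zero)
  import Algebra.Properties.CommutativeSemiring.Binomial commutativeSemiring as Binomial
  open import Relation.Binary.Reasoning.Setoid setoid

  p∣n⇒n·x≈0 : ∀ {n} x → p ∣ n → n · x ≈ 0#
  p∣n⇒n·x≈0 x (divides m ≡.refl) = begin
    (m ℕ.* p) · x        ≈⟨ ×-congˡ (ℕₚ.*-comm m p) ⟩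
    (p ℕ.* m) · x        ≈⟨ ×-assocˡ x p m ⟨
    p · (m · x)          ≈⟨ ×-congʳ p (*-identityˡ _) ⟨
    p · (1# * (m · x))   ≈⟨ ×-assoc-* p 1# _ ⟨
    (p · 1#) * (m · x)   ≈⟨ *-congʳ p·1≈0 ⟩
    0# * (m · x)         ≈⟨ zeroˡ _ ⟩
    0#                   ∎

  private
    -- Writing p as suc n lets the binomial sum split into its first, middle and last terms; the
    -- middle ones vanish by `prime∣C`.
    frobenius-suc : ∀ n → p ≡ suc n → ∀ x y → (x + y) ^ suc n ≈ x ^ suc n + y ^ suc n
    frobenius-suc n ≡.refl x y = begin
      (x + y) ^ suc n
        ≈⟨ Binomial.theorem (suc n) x y ⟩
      term Fin.zero + sum (λ k → term (Fin.suc k))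
        ≈⟨ +-congˡ (sum-init-last (λ k → term (Fin.suc k))) ⟩
      term Fin.zero + (sum (λ k → term (Fin.suc (inject₁ k))) + term (Fin.suc (fromℕ n)))
        ≈⟨ +-cong first (+-cong (trans (sum-cong-≋ middle) (sum-replicate-zero n)) last) ⟩
      y ^ suc n + (0# + x ^ suc n)
        ≈⟨ +-congˡ (+-identityˡ _) ⟩
      y ^ suc n + x ^ suc n
        ≈⟨ +-comm _ _ ⟩
      x ^ suc n + y ^ suc n ∎
      where
      term : Fin (suc (suc n)) → Carrier
      term = Binomial.binomialTerm x y (suc n)
      first : term Fin.zero ≈ y ^ suc n
      first = trans (×-homo-1 _) (*-identityˡ _)
      middle : ∀ k → term (Fin.suc (inject₁ k)) ≈ 0#
      middle k = p∣n⇒n·x≈0 _ (prime∣C p-prime _ (s≤s z≤n)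
        (s≤s (≡.subst (_< n) (≡.sym (Finₚ.toℕ-inject₁ k)) (Finₚ.toℕ<n k))))
      last : term (Fin.suc (fromℕ n)) ≈ x ^ suc n
      last rewrite Finₚ.toℕ-fromℕ n | nCn≡1 (suc n) | ℕₚ.n∸n≡0 n = trans (×-homo-1 _) (*-identityʳ _)

  frobenius : ∀ x y → (x + y) ^ p ≈ x ^ p + y ^ p
  frobenius x y = ≡.subst (λ m → (x + y) ^ m ≈ x ^ m + y ^ m) (ℕₚ.suc-pred p)
    (frobenius-suc (ℕ.pred p) (≡.sym (ℕₚ.suc-pred p)) x y)
    where instance _ = prime⇒nonZero p-prime

  frobenius-iterate : ∀ k x y → (x + y) ^ (p ℕ.^ k) ≈ x ^ (p ℕ.^ k) + y ^ (p ℕ.^ k)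
  frobenius-iterate zero    x y = trans (*-identityʳ _) (sym (+-cong (*-identityʳ x) (*-identityʳ y)))
  frobenius-iterate (suc k) x y = begin
    (x + y) ^ (p ℕ.* p ℕ.^ k)                          ≈⟨ ^-assocʳ (x + y) p (p ℕ.^ k) ⟨
    ((x + y) ^ p) ^ (p ℕ.^ k)                          ≈⟨ ^-congˡ (p ℕ.^ k) (frobenius x y) ⟩
    (x ^ p + y ^ p) ^ (p ℕ.^ k)                        ≈⟨ frobenius-iterate k _ _ ⟩
    (x ^ p) ^ (p ℕ.^ k) + (y ^ p) ^ (p ℕ.^ k)          ≈⟨ +-cong (^-assocʳ x p (p ℕ.^ k)) (^-assocʳ y p (p ℕ.^ k)) ⟩
    x ^ (p ℕ.* p ℕ.^ k) + y ^ (p ℕ.* p ℕ.^ k)          ∎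

-- Finite fields: sums and products over all elements, Fermat's theorem, the characteristic.

module SingleTerm (M : CommutativeMonoid 0ℓ 0ℓ) where
  open CommutativeMonoid M
  open CommutativeMonoidSum M using (sum; sum-cong-≋; sum-replicate-zero)

  sum-single : ∀ {n} (t : Fin n → Carrier) i → (∀ j → j ≢ i → t j ≈ ε) → sum t ≈ t i
  sum-single {suc n} t Fin.zero    h =
    trans (∙-congˡ (trans (sum-cong-≋ λ j → h (Fin.suc j) λ ()) (sum-replicate-zero n))) (identityʳ _)
  sum-single {suc n} t (Fin.suc i) h =
    trans (∙-cong (h Fin.zero λ ()) (sum-single (t ∘ Fin.suc) i λ j j≢i → h (Fin.suc j) (j≢i ∘ Finₚ.suc-injective)))
      (identityˡ _)

module FiniteField (F : CommutativeRing 0ℓ 0ℓ) {q : ℕ} (F-finite : IsFiniteFieldOfSize F q) where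
  open CommutativeRing F
  open import Algebra.Properties.CommutativeSemiring.Exp commutativeSemiring
  open SemiringMult semiring using (×-homo-+; ×1-homo-*; ×-congˡ) renaming (_×_ to _·_)
  open import Algebra.Properties.Ring ring using (+-cancelˡ)
  open import Relation.Binary.Reasoning.Setoid setoid
  open SemiringSolver commutativeSemiring using (solve; _:+_; _:*_; _:=_)

  1≉0 : ¬ (1# ≈ 0#)
  1≉0 = proj₁ F-finite

  inverse : ∀ x → ¬ (x ≈ 0#) → Σ Carrier λ y → x * y ≈ 1#
  inverse = proj₁ (proj₂ F-finite)

  open Bijection (proj₂ (proj₂ F-finite)) using () renaming
    (to to index; cong to index-cong; injective to index-injective; strictlySurjective to index-surjective)

  element : Fin q → Carrier
  element i = proj₁ (index-surjective i)

  index-element : ∀ i → index (element i) ≡ i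
  index-element i = proj₂ (index-surjective i)

  element-index : ∀ x → element (index x) ≈ x
  element-index x = index-injective (index-element (index x))

  infix 4 _≈?_
  _≈?_ : ∀ x y → Dec (x ≈ y)
  x ≈? y = map′ index-injective index-cong (index x Finₚ.≟ index y)

  *-cancel-zero : ∀ {x y} → ¬ (x ≈ 0#) → x * y ≈ 0# → y ≈ 0#
  *-cancel-zero {x} {y} x≉0 xy≈0 with inverse x x≉0
  ... | z , xz≈1 = begin
    y              ≈⟨ *-identityˡ y ⟨
    1# * y         ≈⟨ *-congʳ xz≈1 ⟨
    (x * z) * y    ≈⟨ solve 3 (λ x z y → (x :* z) :* y := z :* (x :* y)) refl x z y ⟩
    z * (x * y)    ≈⟨ *-congˡ xy≈0 ⟩
    z * 0#         ≈⟨ zeroʳ z ⟩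
    0#             ∎

  *-cancelˡ-nonzero : ∀ {x y z} → ¬ (x ≈ 0#) → x * y ≈ x * z → y ≈ z
  *-cancelˡ-nonzero {x} {y} {z} x≉0 xy≈xz with inverse x x≉0
  ... | w , xw≈1 = begin
    y              ≈⟨ *-identityˡ y ⟨
    1# * y         ≈⟨ *-congʳ (trans (*-comm w x) xw≈1) ⟨
    (w * x) * y    ≈⟨ *-assoc w x y ⟩
    w * (x * y)    ≈⟨ *-congˡ xy≈xz ⟩
    w * (x * z)    ≈⟨ *-assoc w x z ⟨
    (w * x) * z    ≈⟨ *-congʳ (trans (*-comm w x) xw≈1) ⟩
    1# * z         ≈⟨ *-identityˡ z ⟩
    z              ∎

  *-nonzero : ∀ {x y} → ¬ (x ≈ 0#) → ¬ (y ≈ 0#) → ¬ (x * y ≈ 0#)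
  *-nonzero x≉0 y≉0 xy≈0 = y≉0 (*-cancel-zero x≉0 xy≈0)

  module _ (M : CommutativeMonoid 0ℓ 0ℓ) where
    private module M = CommutativeMonoid M
    open CommutativeMonoidSum M using (sum; sum-cong-≋; sum-permute)

    -- A bijection g of F permutes the enumeration `element`. It is applied to the translation by 1
    -- in the additive monoid and to the scaling by a in the multiplicative one.
    sum-reindex : (f : Carrier → M.Carrier) → (∀ {x y} → x ≈ y → f x M.≈ f y) →
      (g h : Carrier → Carrier) → (∀ {x y} → x ≈ y → g x ≈ g y) → (∀ {x y} → x ≈ y → h x ≈ h y) →
      (∀ x → g (h x) ≈ x) → (∀ x → h (g x) ≈ x) →
      sum (f ∘ element) M.≈ sum (f ∘ g ∘ element)
    sum-reindex f f-cong g h g-cong h-cong gh hg = M.trans (sum-permute (f ∘ element) π)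
      (sum-cong-≋ λ i → f-cong (element-index (g (element i))))
      where
      roundtrip : ∀ g h → (∀ {x y} → x ≈ y → g x ≈ g y) → (∀ x → g (h x) ≈ x) →
        ∀ i → index (g (element (index (h (element i))))) ≡ i
      roundtrip g h g-cong gh i = ≡.trans
        (index-cong (trans (g-cong (element-index _)) (gh (element i)))) (index-element i)
      π : Perm.Permutation q q
      π = Perm.permutation (index ∘ g ∘ element) (index ∘ h ∘ element)
        (roundtrip g h g-cong gh) (roundtrip h g h-cong hg)

  -- The translation x ↦ x + 1 permutes F, so the sum of all elements equals itself plus q · 1.
  q·1≈0 : q · 1# ≈ 0#
  q·1≈0 = +-cancelˡ (sum element) _ _ (begin
    sum element + q · 1#                       ≈⟨ +-congˡ (sum-replicate q) ⟨
    sum element + sum (replicate q 1#)         ≈⟨ ∑-distrib-+ element (replicate q 1#) ⟨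
    sum (λ i → element i + 1#)                 ≈⟨ sum-reindex +-commutativeMonoid (λ x → x) (λ h → h)
                                                    (_+ 1#) (_+ - 1#) +-congʳ +-congʳ
                                                    (λ x → cancelling (-‿inverseˡ 1#) x) (λ x → cancelling (-‿inverseʳ 1#) x) ⟨
    sum element                                ≈⟨ +-identityʳ _ ⟨
    sum element + 0#                           ∎)
    where
    open CommutativeMonoidSum +-commutativeMonoid using (sum; sum-replicate; ∑-distrib-+)
    cancelling : ∀ {y z} → y + z ≈ 0# → ∀ x → (x + y) + z ≈ x
    cancelling h x = trans (+-assoc _ _ _) (trans (+-congˡ h) (+-identityʳ x))

  module _ {a : Carrier} (a≉0 : ¬ (a ≈ 0#)) where
    private
      open CommutativeMonoidSum *-commutativeMonoid using () renaming
        (sum to prod; sum-cong-≋ to prod-cong; ∑-distrib-+ to prod-distrib-*; sum-replicate to prod-replicate)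

      -- The product over F^* is written as a product over F with 0 skipped.
      ifZero : Carrier → Carrier → Carrier → Carrier
      ifZero u v x with x ≈? 0#
      ... | yes _ = u
      ... | no  _ = v

      ifZero-yes : ∀ {u v x} → x ≈ 0# → ifZero u v x ≡ u
      ifZero-yes {x = x} h with x ≈? 0#
      ... | yes _ = ≡.refl
      ... | no ¬h = contradiction h ¬h

      ifZero-no : ∀ {u v x} → ¬ (x ≈ 0#) → ifZero u v x ≡ v
      ifZero-no {x = x} ¬h with x ≈? 0#
      ... | yes h = contradiction h ¬h
      ... | no _  = ≡.refl

      unit : Carrier → Carrier
      unit x = ifZero 1# x x

      unit-nonzero : ∀ x → ¬ (unit x ≈ 0#)
      unit-nonzero x with x ≈? 0#
      ... | yes _  = 1≉0
      ... | no x≉0 = x≉0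

      unit-cong : ∀ {x y} → x ≈ y → unit x ≈ unit y
      unit-cong {x} {y} h with x ≈? 0# | y ≈? 0#
      ... | yes _ | yes _ = refl
      ... | no _  | no _  = h
      ... | yes k | no ¬k = contradiction (trans (sym h) k) ¬k
      ... | no ¬k | yes k = contradiction (trans h k) ¬k

      unit-scale : ∀ x → unit (a * x) ≈ ifZero 1# a x * unit x
      unit-scale x with x ≈? 0#
      ... | yes h = trans (reflexive (ifZero-yes (trans (*-congˡ h) (zeroʳ a)))) (sym (*-identityˡ 1#))
      ... | no ¬h = reflexive (ifZero-no (*-nonzero a≉0 ¬h))

      complement : ∀ x → ifZero a 1# x * ifZero 1# a x ≈ a
      complement x with x ≈? 0#
      ... | yes _ = *-identityʳ a
      ... | no _  = *-identityˡ a

      prod-nonzero : ∀ {n} (t : Fin n → Carrier) → (∀ i → ¬ (t i ≈ 0#)) → ¬ (prod t ≈ 0#)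
      prod-nonzero {zero}  t h = 1≉0
      prod-nonzero {suc n} t h = *-nonzero (h Fin.zero) (prod-nonzero (t ∘ Fin.suc) (h ∘ Fin.suc))

      -- This product is a^(q-1). Scaling by a permutes F^*, so the product over F^* is unchanged
      -- although every factor has gained an a; that product is nonzero and cancels.
      prod-scales : prod (ifZero 1# a ∘ element) ≈ 1#
      prod-scales = *-cancelˡ-nonzero (prod-nonzero (unit ∘ element) (unit-nonzero ∘ element)) (begin
        prod (unit ∘ element) * prod (ifZero 1# a ∘ element)    ≈⟨ *-comm _ _ ⟩
        prod (ifZero 1# a ∘ element) * prod (unit ∘ element)    ≈⟨ prod-distrib-* _ (unit ∘ element) ⟨
        prod (λ i → ifZero 1# a (element i) * unit (element i)) ≈⟨ prod-cong (λ i → unit-scale (element i)) ⟨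
        prod (λ i → unit (a * element i))                       ≈⟨ sum-reindex *-commutativeMonoid unit unit-cong
                                                                     (a *_) (a⁻¹ *_) *-congˡ *-congˡ
                                                                     (cancelling aa⁻¹≈1) (cancelling (trans (*-comm _ _) aa⁻¹≈1)) ⟨
        prod (unit ∘ element)                                   ≈⟨ *-identityʳ _ ⟨
        prod (unit ∘ element) * 1#                              ∎)
        where
        a⁻¹ = proj₁ (inverse a a≉0)
        aa⁻¹≈1 = proj₂ (inverse a a≉0)
        cancelling : ∀ {y z} → y * z ≈ 1# → ∀ x → y * (z * x) ≈ x
        cancelling h x = trans (sym (*-assoc _ _ _)) (trans (*-congʳ h) (*-identityˡ x))

    -- Each of the q factors a is split by `complement`. The first parts multiply to a single a,
    -- contributed by x = 0; the second parts multiply to a^(q-1) = 1.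
    fermat-nonzero : a ^ q ≈ a
    fermat-nonzero = begin
      a ^ q                                                             ≈⟨ prod-replicate q ⟨
      prod (replicate q a)                                              ≈⟨ prod-cong (λ i → complement (element i)) ⟨
      prod (λ i → ifZero a 1# (element i) * ifZero 1# a (element i))    ≈⟨ prod-distrib-* (ifZero a 1# ∘ element) _ ⟩
      prod (ifZero a 1# ∘ element) * prod (ifZero 1# a ∘ element)       ≈⟨ *-cong prod-single prod-scales ⟩
      a * 1#                                                            ≈⟨ *-identityʳ a ⟩
      a                                                                 ∎
      where
      prod-single : prod (ifZero a 1# ∘ element) ≈ a
      prod-single = trans (SingleTerm.sum-single *-commutativeMonoid _ (index 0#)
        λ j j≢ → reflexive (ifZero-no λ h → j≢ (≡.trans (≡.sym (index-element j)) (index-cong h))))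
        (reflexive (ifZero-yes (element-index 0#)))

  module Characteristic {p k : ℕ} (p-prime : Prime p) (q≡p^k : q ≡ p ℕ.^ k) where

    -- In F the k-th power of p · 1 is q · 1 = 0, and a field has no zero divisors; an exponent k =
    -- 0 would give 1 = 0.
    p·1≈0 : p · 1# ≈ 0#
    p·1≈0 = descend k (trans (×-congˡ (≡.sym q≡p^k)) q·1≈0)
      where
      descend : ∀ k → (p ℕ.^ k) · 1# ≈ 0# → p · 1# ≈ 0#
      descend zero    h = contradiction (trans (sym (+-identityʳ 1#)) h) 1≉0
      descend (suc k) h with p · 1# ≈? 0#
      ... | yes h′ = h′
      ... | no ¬h′ = descend k (*-cancel-zero ¬h′ (trans (sym (×1-homo-* p (p ℕ.^ k))) h))

    -- For 0 < n < p Bézout writes 1 as a combination of n and p, so n · 1 = 0 = p · 1 would force 1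
    -- = 0. The two cases are the two signs in the natural-number form of Bézout.
    n·1≉0 : ∀ {n} → 0 < n → n < p → ¬ (n · 1# ≈ 0#)
    n·1≉0 {n} 0<n n<p h = go (coprime-Bézout (prime⇒coprime p-prime {{ℕ.>-nonZero 0<n}} n<p))
      where
      multiple : ∀ {m} y → m · 1# ≈ 0# → (y ℕ.* m) · 1# ≈ 0#
      multiple {m} y h = trans (×1-homo-* y m) (trans (*-congˡ h) (zeroʳ _))
      absurd : ∀ {m m′} x y → m · 1# ≈ 0# → m′ · 1# ≈ 0# → ¬ (1 ℕ.+ y ℕ.* m ≡ x ℕ.* m′)
      absurd {m} {m′} x y h h′ eq = 1≉0 (begin
        1#                         ≈⟨ +-identityʳ 1# ⟨
        1# + 0#                    ≈⟨ +-congˡ (multiple y h) ⟨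
        (1 ℕ.+ y ℕ.* m) · 1#       ≈⟨ ×-congˡ eq ⟩
        (x ℕ.* m′) · 1#            ≈⟨ multiple x h′ ⟩
        0#                         ∎)
      go : ¬ Bézout.Identity 1 p n
      go (Bézout.+- x y eq) = absurd x y h p·1≈0 eq
      go (Bézout.-+ x y eq) = absurd y x p·1≈0 h eq

    ·1-distinct : ∀ {m n} → m < n → n < p → ¬ (m · 1# ≈ n · 1#)
    ·1-distinct {m} {n} m<n n<p h = n·1≉0 (ℕₚ.m<n⇒0<n∸m m<n) (ℕₚ.≤-<-trans (ℕₚ.m∸n≤m n m) n<p)
      (+-cancelˡ (m · 1#) _ _ (begin
        m · 1# + (n ∸ m) · 1#     ≈⟨ ×-homo-+ 1# m (n ∸ m) ⟨
        (m ℕ.+ (n ∸ m)) · 1#      ≈⟨ ×-congˡ (ℕₚ.m+[n∸m]≡n (ℕₚ.<⇒≤ m<n)) ⟩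
        n · 1#                    ≈⟨ h ⟨
        m · 1#                    ≈⟨ +-identityʳ _ ⟨
        m · 1# + 0#               ∎))

    ·1-injective : ∀ {m n} → m < p → n < p → m · 1# ≈ n · 1# → m ≡ n
    ·1-injective {m} {n} m<p n<p h with ℕₚ.<-cmp m n
    ... | tri≈ _ m≡n _ = m≡n
    ... | tri< m<n _ _ = contradiction h (·1-distinct m<n n<p)
    ... | tri> _ _ n<m = contradiction (sym h) (·1-distinct n<m m<p)

-- Products over exponent vectors, and powers of roots of unity.

weightedBy : (ℕ → ℕ) → ℕ → ∀ {n} → Vec ℕ n → ℕ
weightedBy N s []       = 0
weightedBy N s (u ∷ us) = N s ℕ.* u ℕ.+ weightedBy N (suc s) us

weightedBy-id : ∀ s {n} (u : Vec ℕ n) → weightedBy (λ j → j) s u ≡ weightedFrom s u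
weightedBy-id s []       = ≡.refl
weightedBy-id s (u ∷ us) = ≡.cong (s ℕ.* u ℕ.+_) (weightedBy-id (suc s) us)

module VectorProduct (R : CommutativeRing 0ℓ 0ℓ) where
  open CommutativeRing R
  open import Algebra.Properties.CommutativeSemiring.Exp commutativeSemiring
  open import Relation.Binary.Reasoning.Setoid setoid
  open SemiringSolver commutativeSemiring using (solve; _:+_; _:*_; _:=_)

  ∏ : (ℕ → Carrier) → ℕ → ∀ {n} → Vec ℕ n → Carrier
  ∏ f s []       = 1#
  ∏ f s (u ∷ us) = f s ^ u * ∏ f (suc s) us

  ∏-cong : ∀ {f g} s {n} (u : Vec ℕ n) → (∀ j → s ≤ j → j < s ℕ.+ n → f j ≈ g j) → ∏ f s u ≈ ∏ g s u
  ∏-cong s []       h = refl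
  ∏-cong s {suc n} (u ∷ us) h = *-cong
    (^-congˡ u (h s ℕₚ.≤-refl (ℕₚ.m<m+n s (s≤s z≤n))))
    (∏-cong (suc s) us λ j s<j j< → h j (ℕₚ.<⇒≤ s<j) (≡.subst (j <_) (≡.sym (ℕₚ.+-suc s n)) j<))

  ∏-* : ∀ f g s {n} (u : Vec ℕ n) → ∏ (λ j → f j * g j) s u ≈ ∏ f s u * ∏ g s u
  ∏-* f g s []       = sym (*-identityˡ 1#)
  ∏-* f g s (u ∷ us) = begin
    (f s * g s) ^ u * ∏ (λ j → f j * g j) (suc s) us             ≈⟨ *-cong (^-distrib-* (f s) (g s) u) (∏-* f g (suc s) us) ⟩
    (f s ^ u * g s ^ u) * (∏ f (suc s) us * ∏ g (suc s) us)      ≈⟨ solve 4 (λ x y z w → (x :* y) :* (z :* w) := (x :* z) :* (y :* w)) refl _ _ _ _ ⟩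
    (f s ^ u * ∏ f (suc s) us) * (g s ^ u * ∏ g (suc s) us)      ∎

  ∏-^ : ∀ x N s {n} (u : Vec ℕ n) → ∏ (λ j → x ^ N j) s u ≈ x ^ weightedBy N s u
  ∏-^ x N s []       = refl
  ∏-^ x N s (u ∷ us) = begin
    (x ^ N s) ^ u * ∏ (λ j → x ^ N j) (suc s) us      ≈⟨ *-cong (^-assocʳ x (N s) u) (∏-^ x N (suc s) us) ⟩
    x ^ (N s ℕ.* u) * x ^ weightedBy N (suc s) us     ≈⟨ ^-homo-* x (N s ℕ.* u) _ ⟨
    x ^ (N s ℕ.* u ℕ.+ weightedBy N (suc s) us)       ∎

  -- The twists collect into a power of x that depends on the weight of u alone, hence is the same
  -- for all partitions of one number.
  ∏-twist : ∀ x f s {n} (u : Vec ℕ n) → ∏ (λ j → x ^ j * f j) s u ≈ x ^ weightedFrom s u * ∏ f s u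
  ∏-twist x f s u = trans (∏-* (x ^_) f s u)
    (*-congʳ (trans (∏-^ x (λ j → j) s u) (^-congʳ x (weightedBy-id s u))))

module Periodic (R : CommutativeRing 0ℓ 0ℓ) where
  open CommutativeRing R
  open import Algebra.Properties.CommutativeSemiring.Exp commutativeSemiring
  open import Relation.Binary.Reasoning.Setoid setoid

  1^n≈1 : ∀ n → 1# ^ n ≈ 1#
  1^n≈1 zero    = refl
  1^n≈1 (suc n) = trans (*-identityˡ _) (1^n≈1 n)

  ^-multiple : ∀ {x k} → x ^ k ≈ 1# → ∀ m → x ^ (m ℕ.* k) ≈ 1#
  ^-multiple {x} {k} h m = begin
    x ^ (m ℕ.* k)     ≈⟨ ^-congʳ x (ℕₚ.*-comm m k) ⟩
    x ^ (k ℕ.* m)     ≈⟨ ^-assocʳ x k m ⟨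
    (x ^ k) ^ m       ≈⟨ ^-congˡ m h ⟩
    1# ^ m            ≈⟨ 1^n≈1 m ⟩
    1#                ∎

  ^-mod : ∀ {x k i j} → x ^ k ≈ 1# → i ≡ j [mod k ] → x ^ i ≈ x ^ j
  ^-mod {x} {k} {i} {j} h (m , n , eq) = begin
    x ^ i                       ≈⟨ drop i m ⟨
    x ^ (i ℕ.+ m ℕ.* k)         ≈⟨ ^-congʳ x eq ⟩
    x ^ (j ℕ.+ n ℕ.* k)         ≈⟨ drop j n ⟩
    x ^ j                       ∎
    where
    drop : ∀ i m → x ^ (i ℕ.+ m ℕ.* k) ≈ x ^ i
    drop i m = trans (^-homo-* x i (m ℕ.* k)) (trans (*-congˡ (^-multiple h m)) (*-identityʳ _))

  -- From x x^k = 1 the inverse of x^i is x^(i k), so cancellation works in any ring.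
  ^-cancelˡ : ∀ {x k} → x ^ suc k ≈ 1# → ∀ i {y z} → x ^ i * y ≈ x ^ i * z → y ≈ z
  ^-cancelˡ {x} {k} h i {y} {z} eq = begin
    y                             ≈⟨ undo y ⟨
    x ^ (i ℕ.* k) * (x ^ i * y)   ≈⟨ *-congˡ eq ⟩
    x ^ (i ℕ.* k) * (x ^ i * z)   ≈⟨ undo z ⟩
    z                             ∎
    where
    undo : ∀ y → x ^ (i ℕ.* k) * (x ^ i * y) ≈ y
    undo y = begin
      x ^ (i ℕ.* k) * (x ^ i * y)   ≈⟨ *-assoc _ _ y ⟨
      (x ^ (i ℕ.* k) * x ^ i) * y   ≈⟨ *-congʳ (^-homo-* x (i ℕ.* k) i) ⟨
      x ^ (i ℕ.* k ℕ.+ i) * y       ≈⟨ *-congʳ (^-congʳ x (≡.trans (ℕₚ.+-comm (i ℕ.* k) i) (≡.sym (ℕₚ.*-suc i k)))) ⟩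
      x ^ (i ℕ.* suc k) * y         ≈⟨ *-congʳ (^-multiple h i) ⟩
      1# * y                        ≈⟨ *-identityˡ y ⟩
      y                             ∎

-- Powers of θ^w (θ + a) as products over partitions.

mod-*ˡ : ∀ c {i j r} → i ≡ j [mod r ] → c ℕ.* i ≡ c ℕ.* j [mod r ]
mod-*ˡ c {i} {j} {r} (m , n , eq) = c ℕ.* m , c ℕ.* n , (begin
  c ℕ.* i ℕ.+ (c ℕ.* m) ℕ.* r     ≡⟨ ≡.cong (c ℕ.* i ℕ.+_) (ℕₚ.*-assoc c m r) ⟩
  c ℕ.* i ℕ.+ c ℕ.* (m ℕ.* r)     ≡⟨ ℕₚ.*-distribˡ-+ c i _ ⟨
  c ℕ.* (i ℕ.+ m ℕ.* r)           ≡⟨ ≡.cong (c ℕ.*_) eq ⟩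
  c ℕ.* (j ℕ.+ n ℕ.* r)           ≡⟨ ℕₚ.*-distribˡ-+ c j _ ⟩
  c ℕ.* j ℕ.+ c ℕ.* (n ℕ.* r)     ≡⟨ ≡.cong (c ℕ.* j ℕ.+_) (ℕₚ.*-assoc c n r) ⟨
  c ℕ.* j ℕ.+ (c ℕ.* n) ℕ.* r     ∎)
  where open ≡.≡-Reasoning

-- Combines additivity of z ↦ z^(q^n) with a^(q^n) = a: conjugating z + a changes z only.
FrobeniusFixes : (R : CommutativeRing 0ℓ 0ℓ) → ℕ → CommutativeRing.Carrier R → Set
FrobeniusFixes R q a = ∀ z n → (z + a) ^ (q ℕ.^ n) ≈ z ^ (q ℕ.^ n) + a
  where
  open CommutativeRing R
  open SemiringExp semiring using (_^_)

module Orbit {q r′ : ℕ} (r-prime : Prime (suc r′)) (q⊥r : Coprime q (suc r′)) (q-primitive : IsPrimitiveRoot q (suc r′))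
             (R : CommutativeRing 0ℓ 0ℓ) (a : CommutativeRing.Carrier R) (frobenius : FrobeniusFixes R q a) where
  open CommutativeRing R
  open import Algebra.Properties.CommutativeSemiring.Exp commutativeSemiring
  open import Relation.Binary.Reasoning.Setoid setoid
  open SemiringSolver commutativeSemiring using (solve; _:+_; _:*_; _:=_)
  open PrimitiveRoot r-prime q⊥r q-primitive
  open VectorProduct R
  open Periodic R
  private
    r : ℕ
    r = suc r′

  -- Kept general in z because it is evaluated both at θ and at its inverse.
  twisted : ℕ → Carrier → Carrier
  twisted w z = z ^ w * (z + a)

  exponent : ∀ {n} → Vec ℕ n → ℕ
  exponent = weightedBy (λ j → q ℕ.^ log j) 1

  twisted-^q : ∀ {z} → z ^ r ≈ 1# → ∀ w n j → q ℕ.^ n ≡ j [mod r ] →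
    twisted w z ^ (q ℕ.^ n) ≈ (z ^ w) ^ j * (z ^ j + a)
  twisted-^q {z} z^r≈1 w n j eq = begin
    (z ^ w * (z + a)) ^ (q ℕ.^ n)                    ≈⟨ ^-distrib-* (z ^ w) (z + a) (q ℕ.^ n) ⟩
    (z ^ w) ^ (q ℕ.^ n) * (z + a) ^ (q ℕ.^ n)        ≈⟨ *-cong (^-assocʳ z w (q ℕ.^ n)) (frobenius z n) ⟩
    z ^ (w ℕ.* q ℕ.^ n) * (z ^ (q ℕ.^ n) + a)        ≈⟨ *-cong (^-mod z^r≈1 (mod-*ˡ w eq)) (+-congʳ (^-mod z^r≈1 eq)) ⟩
    z ^ (w ℕ.* j) * (z ^ j + a)                      ≈⟨ *-congʳ (^-assocʳ z w j) ⟨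
    (z ^ w) ^ j * (z ^ j + a)                        ∎

  twisted-exponent : ∀ {z} → z ^ r ≈ 1# → ∀ w {n} → n < r → (u : Vec ℕ n) →
    twisted w z ^ exponent u ≈ (z ^ w) ^ weightedFrom 1 u * ∏ (λ j → z ^ j + a) 1 u
  twisted-exponent {z} z^r≈1 w n<r u = begin
    twisted w z ^ exponent u                                    ≈⟨ ∏-^ (twisted w z) _ 1 u ⟨
    -- Here n < r is used: the indices 1, ..., n are not multiples of r, so `log` does not take its
    -- default value.
    ∏ (λ j → twisted w z ^ (q ℕ.^ log j)) 1 u                   ≈⟨ ∏-cong 1 u (λ j 1≤j j≤n → twisted-^q z^r≈1 w (log j) j
                                                                     (q^log λ r∣j → ℕₚ.<⇒≱ (ℕₚ.<-≤-trans j≤n n<r)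
                                                                       (∣⇒≤ {{ℕ.>-nonZero 1≤j}} r∣j))) ⟩
    ∏ (λ j → (z ^ w) ^ j * (z ^ j + a)) 1 u                     ≈⟨ ∏-twist (z ^ w) _ 1 u ⟩
    (z ^ w) ^ weightedFrom 1 u * ∏ (λ j → z ^ j + a) 1 u        ∎

  -- Raising to a suitable power of q turns the exponent f into 1.
  normalise : ∀ {θ} → θ ^ r ≈ 1# → ∀ e f n {k} → f ℕ.* q ℕ.^ n ≡ 1 [mod r ] →
    (θ ^ e * (θ ^ f + a)) ^ k ≈ 1# → twisted (e ℕ.* q ℕ.^ n) θ ^ k ≈ 1#
  normalise {θ} θ^r≈1 e f n {k} eq h = begin
    (θ ^ (e ℕ.* Q) * (θ + a)) ^ k                  ≈⟨ ^-congˡ k (*-congˡ (+-congʳ (trans (sym (*-identityʳ θ)) (sym (^-mod θ^r≈1 eq))))) ⟩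
    (θ ^ (e ℕ.* Q) * (θ ^ (f ℕ.* Q) + a)) ^ k      ≈⟨ ^-congˡ k (*-cong (^-assocʳ θ e Q) (+-congʳ (^-assocʳ θ f Q))) ⟨
    ((θ ^ e) ^ Q * ((θ ^ f) ^ Q + a)) ^ k          ≈⟨ ^-congˡ k (*-congˡ (frobenius (θ ^ f) n)) ⟨
    ((θ ^ e) ^ Q * (θ ^ f + a) ^ Q) ^ k            ≈⟨ ^-congˡ k (^-distrib-* _ _ Q) ⟨
    ((θ ^ e * (θ ^ f + a)) ^ Q) ^ k                ≈⟨ ^-assocʳ (θ ^ e * (θ ^ f + a)) Q k ⟩
    (θ ^ e * (θ ^ f + a)) ^ (Q ℕ.* k)              ≈⟨ ^-multiple h Q ⟩
    1#                                             ∎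
    where Q = q ℕ.^ n

  module _ {θ : Carrier} (θ^r≈1 : θ ^ r ≈ 1#) (w : ℕ) {k : ℕ} (power≈1 : twisted w θ ^ k ≈ 1#) where

    -- Both powers carry the same twist θ^(w m), since u and v have the same weight m, and it is a
    -- unit.
    products-agree : ∀ {n m} → n < r → (u v : Vec ℕ n) → weightedFrom 1 u ≡ m → weightedFrom 1 v ≡ m →
      exponent u ≡ exponent v [mod k ] →
      ∏ (λ j → θ ^ j + a) 1 u ≈ ∏ (λ j → θ ^ j + a) 1 v
    products-agree {m = m} n<r u v wu wv eq = ^-cancelˡ {θ} {r′} θ^r≈1 (w ℕ.* m) (begin
      θ ^ (w ℕ.* m) * ∏ (λ j → θ ^ j + a) 1 u    ≈⟨ expand u wu ⟨
      twisted w θ ^ exponent u                   ≈⟨ ^-mod power≈1 eq ⟩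
      twisted w θ ^ exponent v                   ≈⟨ expand v wv ⟩
      θ ^ (w ℕ.* m) * ∏ (λ j → θ ^ j + a) 1 v    ∎)
      where
      expand : ∀ u → weightedFrom 1 u ≡ m → twisted w θ ^ exponent u ≈ θ ^ (w ℕ.* m) * ∏ (λ j → θ ^ j + a) 1 u
      expand u ≡.refl = trans (twisted-exponent θ^r≈1 w n<r u) (*-congʳ (^-assocʳ θ w _))

    module _ (0<r′ : 0 < r′) where
      private
        -- The inverse of θ, since θ θ^r′ = θ^r = 1.
        ω : Carrier
        ω = θ ^ r′

        ω^r≈1 : ω ^ r ≈ 1#
        ω^r≈1 = trans (^-assocʳ θ r′ r) (^-multiple {θ} {r} θ^r≈1 r′)

        ω^r′≈θ : ω ^ r′ ≈ θ
        ω^r′≈θ = begin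
          ω ^ r′                ≈⟨ *-identityˡ _ ⟨
          1# * ω ^ r′           ≈⟨ *-congʳ θ^r≈1 ⟨
          (θ * ω) * ω ^ r′      ≈⟨ *-assoc θ ω _ ⟩
          θ * ω ^ r             ≈⟨ *-congˡ ω^r≈1 ⟩
          θ * 1#                ≈⟨ *-identityʳ θ ⟩
          θ                     ∎

        h : ℕ
        h = log r′

        q^h≡-1 : q ℕ.^ h ≡ r′ [mod r ]
        q^h≡-1 = q^log λ r∣r′ → ℕₚ.<⇒≱ (ℕₚ.n<1+n r′) (∣⇒≤ {{ℕ.>-nonZero 0<r′}} r∣r′)

        ^-swap : ∀ x m n → (x ^ m) ^ n ≈ (x ^ n) ^ m
        ^-swap x m n = trans (^-assocʳ x m n) (trans (^-congʳ x (ℕₚ.*-comm m n)) (sym (^-assocʳ x n m)))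

        twisted-θ→ω : twisted w θ ^ (q ℕ.^ h) ≈ twisted w ω
        twisted-θ→ω = trans (twisted-^q θ^r≈1 w h r′ q^h≡-1) (*-congʳ (^-swap θ w r′))

        twisted-ω→θ : twisted w ω ^ (q ℕ.^ h) ≈ twisted w θ
        twisted-ω→θ = begin
          twisted w ω ^ (q ℕ.^ h)            ≈⟨ twisted-^q ω^r≈1 w h r′ q^h≡-1 ⟩
          (ω ^ w) ^ r′ * (ω ^ r′ + a)        ≈⟨ *-cong (trans (^-swap ω w r′) (^-congˡ w ω^r′≈θ)) (+-congʳ ω^r′≈θ) ⟩
          twisted w θ                        ∎

      -- The power q^h inverts r-th roots of unity.
      pairExponent : ∀ {n} → Vec ℕ n → Vec ℕ n → ℕ
      pairExponent u v = exponent u ℕ.+ (q ℕ.^ h) ℕ.* exponent v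

      private
        split : ∀ {n} (u v : Vec ℕ n) →
          twisted w θ ^ pairExponent u v ≈ twisted w θ ^ exponent u * twisted w ω ^ exponent v
        split u v = trans (^-homo-* (twisted w θ) (exponent u) _)
          (*-congˡ (trans (sym (^-assocʳ (twisted w θ) (q ℕ.^ h) (exponent v))) (^-congˡ (exponent v) twisted-θ→ω)))

        -- The q^h-th power interchanges `twisted w θ` and `twisted w ω`, and with them the roles of
        -- u and v.
        split-conjugate : ∀ {n} (u v : Vec ℕ n) →
          (twisted w θ ^ pairExponent u v) ^ (q ℕ.^ h) ≈ twisted w θ ^ exponent v * twisted w ω ^ exponent u
        split-conjugate u v = begin
          (twisted w θ ^ pairExponent u v) ^ (q ℕ.^ h)
            ≈⟨ ^-congˡ (q ℕ.^ h) (split u v) ⟩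
          (twisted w θ ^ exponent u * twisted w ω ^ exponent v) ^ (q ℕ.^ h)
            ≈⟨ ^-distrib-* _ _ (q ℕ.^ h) ⟩
          (twisted w θ ^ exponent u) ^ (q ℕ.^ h) * (twisted w ω ^ exponent v) ^ (q ℕ.^ h)
            ≈⟨ *-cong (^-swap (twisted w θ) (exponent u) (q ℕ.^ h)) (^-swap (twisted w ω) (exponent v) (q ℕ.^ h)) ⟩
          (twisted w θ ^ (q ℕ.^ h)) ^ exponent u * (twisted w ω ^ (q ℕ.^ h)) ^ exponent v
            ≈⟨ *-cong (^-congˡ (exponent u) twisted-θ→ω) (^-congˡ (exponent v) twisted-ω→θ) ⟩
          twisted w ω ^ exponent u * twisted w θ ^ exponent v
            ≈⟨ *-comm _ _ ⟩
          twisted w θ ^ exponent v * twisted w ω ^ exponent u ∎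

        -- The factor θ^m is the product of the θ^(j v_j); it turns each ω^j + a into 1 + a θ^j, a
        -- polynomial in θ. The twists θ^(w m) and ω^(w m) are inverse to each other because u and v
        -- have equal weight.
        clear-denominators : ∀ {n m} → n < r → (u v : Vec ℕ n) → weightedFrom 1 u ≡ m → weightedFrom 1 v ≡ m →
          θ ^ m * (twisted w θ ^ exponent u * twisted w ω ^ exponent v) ≈
          ∏ (λ j → θ ^ j + a) 1 u * ∏ (λ j → 1# + a * θ ^ j) 1 v
        clear-denominators {m = m} n<r u v wu wv = begin
          θ ^ m * (twisted w θ ^ exponent u * twisted w ω ^ exponent v)
            ≈⟨ *-congˡ (*-cong (twisted-exponent θ^r≈1 w n<r u) (twisted-exponent ω^r≈1 w n<r v)) ⟩
          θ ^ m * (((θ ^ w) ^ weightedFrom 1 u * ∏ F 1 u) * ((ω ^ w) ^ weightedFrom 1 v * ∏ F⁻ 1 v))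
            ≈⟨ *-congˡ (*-cong (*-congʳ (^-congʳ _ wu)) (*-congʳ (^-congʳ _ wv))) ⟩
          θ ^ m * (((θ ^ w) ^ m * ∏ F 1 u) * ((ω ^ w) ^ m * ∏ F⁻ 1 v))
            ≈⟨ solve 5 (λ t x p y p′ → t :* ((x :* p) :* (y :* p′)) := (x :* y) :* (p :* (t :* p′))) refl _ _ _ _ _ ⟩
          ((θ ^ w) ^ m * (ω ^ w) ^ m) * (∏ F 1 u * (θ ^ m * ∏ F⁻ 1 v))
            ≈⟨ *-cong twists-cancel (*-congˡ (*-congʳ (^-congʳ θ (≡.sym wv)))) ⟩
          1# * (∏ F 1 u * (θ ^ weightedFrom 1 v * ∏ F⁻ 1 v))
            ≈⟨ *-identityˡ _ ⟩
          ∏ F 1 u * (θ ^ weightedFrom 1 v * ∏ F⁻ 1 v)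
            ≈⟨ *-congˡ (∏-twist θ F⁻ 1 v) ⟨
          ∏ F 1 u * ∏ (λ j → θ ^ j * (ω ^ j + a)) 1 v
            ≈⟨ *-congˡ (∏-cong 1 v λ j _ _ → reverse-factor j) ⟩
          ∏ F 1 u * ∏ (λ j → 1# + a * θ ^ j) 1 v ∎
          where
          F F⁻ : ℕ → Carrier
          F j  = θ ^ j + a
          F⁻ j = ω ^ j + a
          powers-cancel : ∀ j → θ ^ j * ω ^ j ≈ 1#
          powers-cancel j = trans (sym (^-distrib-* θ ω j)) (trans (^-congˡ j θ^r≈1) (1^n≈1 j))
          twists-cancel : (θ ^ w) ^ m * (ω ^ w) ^ m ≈ 1#
          twists-cancel = trans (sym (^-distrib-* _ _ m)) (trans (^-congˡ m (powers-cancel w)) (1^n≈1 m))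
          reverse-factor : ∀ j → θ ^ j * (ω ^ j + a) ≈ 1# + a * θ ^ j
          reverse-factor j = trans (distribˡ _ _ a) (+-cong (powers-cancel j) (*-comm _ a))

      pair-products-agree : ∀ {n m} → n < r → (u v u′ v′ : Vec ℕ n) →
        weightedFrom 1 u ≡ m → weightedFrom 1 v ≡ m → weightedFrom 1 u′ ≡ m → weightedFrom 1 v′ ≡ m →
        pairExponent u v ≡ pairExponent u′ v′ [mod k ] →
        (∏ (λ j → θ ^ j + a) 1 u * ∏ (λ j → 1# + a * θ ^ j) 1 v ≈
         ∏ (λ j → θ ^ j + a) 1 u′ * ∏ (λ j → 1# + a * θ ^ j) 1 v′) ×
        (∏ (λ j → θ ^ j + a) 1 v * ∏ (λ j → 1# + a * θ ^ j) 1 u ≈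
         ∏ (λ j → θ ^ j + a) 1 v′ * ∏ (λ j → 1# + a * θ ^ j) 1 u′)
      pair-products-agree n<r u v u′ v′ wu wv wu′ wv′ eq =
        trans (sym (clear-denominators n<r u v wu wv))
          (trans (*-congˡ (trans (sym (split u v)) (trans powers-agree (split u′ v′))))
            (clear-denominators n<r u′ v′ wu′ wv′)) ,
        trans (sym (clear-denominators n<r v u wv wu))
          (trans (*-congˡ (trans (sym (split-conjugate u v))
              (trans (^-congˡ (q ℕ.^ h) powers-agree) (split-conjugate u′ v′))))
            (clear-denominators n<r v′ u′ wv′ wu′))
        where
        powers-agree : twisted w θ ^ pairExponent u v ≈ twisted w θ ^ pairExponent u′ v′
        powers-agree = ^-mod power≈1 eq

module Identities (R : CommutativeRing 0ℓ 0ℓ) where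
  open CommutativeRing R
  open SemiringSolver commutativeSemiring using (solve; _:+_; _:*_; _:=_)

  *-interchange : ∀ x y z w → (x * y) * (z * w) ≈ (x * z) * (y * w)
  *-interchange = solve 4 (λ x y z w → (x :* y) :* (z :* w) := (x :* z) :* (y :* w)) refl

  *-interchange-swap : ∀ x y z w → (x * y) * (z * w) ≈ (x * w) * (z * y)
  *-interchange-swap = solve 4 (λ x y z w → (x :* y) :* (z :* w) := (x :* w) :* (z :* y)) refl

  -- With `x * n` in the role of X^(k+1): only a t′ + t a′ has exactly this order. The product of
  -- the two higher parts contains `x * n` twice, and the second copy supplies the extra factor x.
  expansion-product : ∀ a t x n g a′ t′ g′ →
    (a + (x * n) * (t + x * g)) * (a′ + (x * n) * (t′ + x * g′)) ≈
    a * a′ + (x * n) * ((a * t′ + t * a′) + x * (g * a′ + a * g′ + n * ((t + x * g) * (t′ + x * g′))))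
  expansion-product = solve 8 (λ a t x n g a′ t′ g′ →
    (a :+ (x :* n) :* (t :+ x :* g)) :* (a′ :+ (x :* n) :* (t′ :+ x :* g′)) :=
    a :* a′ :+ (x :* n) :* ((a :* t′ :+ t :* a′) :+ x :* (g :* a′ :+ a :* g′ :+ n :* ((t :+ x :* g) :* (t′ :+ x :* g′))))) refl

  reciprocal-product : ∀ y a e → (y + a) * (e + a * y) ≈ (a * e + (y * y) * a) + y * (e + a * a)
  reciprocal-product = solve 3 (λ y a e → (y :+ a) :* (e :+ a :* y) := (a :* e :+ (y :* y) :* a) :+ y :* (e :+ a :* a)) refl

-- Degrees of polynomials and reduction modulo Φ_r.

module Polynomials (F : CommutativeRing 0ℓ 0ℓ) where
  open CommutativeRing F
  open Poly F
  open PolynomialRing F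
  private module P = CommutativeRing F[x]
  open import Algebra.Properties.CommutativeSemiring.Exp P.commutativeSemiring
  open VectorProduct F[x]

  C : Carrier → Pol
  C c = c ∷ []

  X : Pol
  X = 0# ∷ oneP

  X-* : ∀ p → X *P p ≋ 0# ∷ p
  X-* p = ≋-trans (shift-*P oneP p) (∷-cong refl (*P-identityˡ p))

  C-* : ∀ c d → C (c * d) ≋ C c *P C d
  C-* c d = ∷-cong (sym (+-identityʳ _)) ≋-refl

  C-cong : ∀ {c d} → c ≈ d → C c ≋ C d
  C-cong h = ∷-cong h ≋-refl

  C-zero : C 0# ≋ []
  C-zero = pointwise λ { zero → refl ; (suc _) → refl }

  xPow≋X^ : ∀ n → xPow n ≋ X ^ n
  xPow≋X^ zero    = ≋-refl
  xPow≋X^ (suc n) = ≋-trans (∷-cong refl (xPow≋X^ n)) (≋-sym (X-* (X ^ n)))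

  ^P≡^ : ∀ p n → p ^P n ≡ p ^ n
  ^P≡^ p zero    = ≡.refl
  ^P≡^ p (suc n) = ≡.cong (p *P_) (^P≡^ p n)

  coeff-X^-* : ∀ k p n → coeff ((X ^ k) *P p) (k ℕ.+ n) ≈ coeff p n
  coeff-X^-* zero    p n = at (*P-identityˡ p) n
  coeff-X^-* (suc k) p n = trans
    (at (≋-trans (*P-assoc X (X ^ k) p) (X-* ((X ^ k) *P p))) (suc (k ℕ.+ n))) (coeff-X^-* k p n)

  coeff-X^-*-zero : ∀ k p → coeff ((X ^ suc k) *P p) 0 ≈ 0#
  coeff-X^-*-zero k p = at (≋-trans (*P-assoc X (X ^ k) p) (X-* ((X ^ k) *P p))) 0

  coeff-beyond : ∀ p {n} → length p ≤ n → coeff p n ≈ 0#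
  coeff-beyond []       _          = refl
  coeff-beyond (a ∷ as) (s≤s len≤) = coeff-beyond as len≤

  length-+P : ∀ p q → length (p +P q) ≡ length p ⊔ length q
  length-+P []       q        = ≡.refl
  length-+P (a ∷ as) []       = ≡.refl
  length-+P (a ∷ as) (b ∷ bs) = ≡.cong suc (length-+P as bs)

  length-+P-≤ : ∀ {n} p q → length p ≤ n → length q ≤ n → length (p +P q) ≤ n
  length-+P-≤ {n} p q hp hq = ≡.subst (_≤ n) (≡.sym (length-+P p q)) (ℕₚ.⊔-lub hp hq)

  -- A length of at most suc d stands for a degree of at most d. Trailing zeros may make lists
  -- longer than necessary, but upper bounds are all that is wanted.
  length-*P : ∀ {d e} p q → length p ≤ suc d → length q ≤ suc e → length (p *P q) ≤ suc (d ℕ.+ e)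
  length-*P []       q _  _  = z≤n
  length-*P {d} {e} (a ∷ as) q hp hq = length-+P-≤ (scale a q) (0# ∷ (as *P q))
    (≡.subst (_≤ suc (d ℕ.+ e)) (≡.sym (length-map (a *_) q)) (ℕₚ.≤-trans hq (s≤s (ℕₚ.m≤n+m e d))))
    (s≤s (tail d as (ℕ.s≤s⁻¹ hp)))
    where
    tail : ∀ d as → length as ≤ d → length (as *P q) ≤ d ℕ.+ e
    tail d       []          _  = z≤n
    tail (suc d) as@(_ ∷ _)  h  = length-*P as q h hq

  length-^ : ∀ {d} p n → length p ≤ suc d → length (p ^ n) ≤ suc (d ℕ.* n)
  length-^ {d} p zero    h = ≡.subst (λ m → 1 ≤ suc m) (≡.sym (ℕₚ.*-zeroʳ d)) ℕₚ.≤-refl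
  length-^ {d} p (suc n) h = ≡.subst (λ m → length (p *P (p ^ n)) ≤ suc m) (≡.sym (ℕₚ.*-suc d n))
    (length-*P p (p ^ n) h (length-^ p n h))

  length-X^ : ∀ n → length (X ^ n) ≤ suc n
  length-X^ n = ≡.subst (λ m → length (X ^ n) ≤ suc m) (ℕₚ.*-identityˡ n) (length-^ X n ℕₚ.≤-refl)

  -- The weight Σ j u_j bounds the degree when f j has degree at most j; for partitions this bound
  -- is the number partitioned.
  length-∏ : ∀ f → (∀ j → length (f j) ≤ suc j) → ∀ s {n} (u : Vec ℕ n) → length (∏ f s u) ≤ suc (weightedFrom s u)
  length-∏ f h s []       = s≤s z≤n
  length-∏ f h s (u ∷ us) = length-*P (f s ^ u) _ (length-^ (f s) u (h s)) (length-∏ f h (suc s) us)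

  coeff-replicate : ∀ {m n} → n < m → coeff (List.replicate m 1#) n ≈ 1#
  coeff-replicate {suc m} {zero}  _         = refl
  coeff-replicate {suc m} {suc n} (s≤s n<m) = coeff-replicate n<m

  -- Φ_r is monic of degree r′. Beyond r′ the constant term of g contributes nothing, so the tail of
  -- g satisfies the same hypothesis and vanishes by induction; the coefficient at r′ is then the
  -- constant term itself.
  Φ-multiple-zero : ∀ r′ g → (∀ n → r′ ≤ n → coeff (Φ (suc r′) *P g) n ≈ 0#) → g ≋ []
  Φ-multiple-zero r′ []       h = ≋-refl
  Φ-multiple-zero r′ (b ∷ bs) h = pointwise λ { zero → b≈0 ; (suc n) → at bs≋0 n }
    where
    open import Relation.Binary.Reasoning.Setoid setoid
    expand : ∀ n → coeff (Φ (suc r′) *P (b ∷ bs)) n ≈ b * coeff (Φ (suc r′)) n + coeff (0# ∷ (Φ (suc r′) *P bs)) n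
    expand n = trans (at (*P-∷ʳ (Φ (suc r′)) b bs) n)
      (trans (coeff-+ (scale b (Φ (suc r′))) (0# ∷ (Φ (suc r′) *P bs)) n) (+-congʳ (coeff-scale b (Φ (suc r′)) n)))
    bs≋0 : bs ≋ []
    bs≋0 = Φ-multiple-zero r′ bs λ n r′≤n → begin
      coeff (Φ (suc r′) *P bs) n
        ≈⟨ +-identityˡ _ ⟨
      0# + coeff (Φ (suc r′) *P bs) n
        ≈⟨ +-congʳ (trans (*-congˡ (coeff-beyond (Φ (suc r′))
             (≡.subst (_≤ suc n) (≡.sym (length-replicate (suc r′))) (s≤s r′≤n)))) (zeroʳ b)) ⟨
      b * coeff (Φ (suc r′)) (suc n) + coeff (Φ (suc r′) *P bs) n
        ≈⟨ expand (suc n) ⟨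
      coeff (Φ (suc r′) *P (b ∷ bs)) (suc n)
        ≈⟨ h (suc n) (ℕₚ.m≤n⇒m≤1+n r′≤n) ⟩
      0# ∎
    b≈0 : b ≈ 0#
    b≈0 = begin
      b                                                                   ≈⟨ *-identityʳ b ⟨
      b * 1#                                                              ≈⟨ +-identityʳ _ ⟨
      b * 1# + 0#                                                         ≈⟨ +-cong (*-congˡ (coeff-replicate (ℕₚ.n<1+n r′)))
                                                                               (at (≋-trans (∷-cong refl (≋-trans (*P-congˡ (Φ (suc r′)) bs≋0) (*P-zeroʳ (Φ (suc r′))))) C-zero) r′) ⟨
      b * coeff (Φ (suc r′)) r′ + coeff (0# ∷ (Φ (suc r′) *P bs)) r′      ≈⟨ expand r′ ⟨
      coeff (Φ (suc r′) *P (b ∷ bs)) r′                                   ≈⟨ h r′ ℕₚ.≤-refl ⟩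
      0#                                                                  ∎

  -- The identity (x - 1) Φ_r = x^r - 1 without subtraction, which permits induction on r.
  X*Φ : ∀ r → oneP +P (X *P Φ r) ≋ Φ r +P (X ^ r)
  X*Φ zero    = ≋-trans (+P-cong (≋-refl {oneP}) (*P-zeroʳ X)) (+P-identityʳ oneP)
  X*Φ (suc r) = ≋-trans (+P-cong (≋-refl {oneP}) (≋-trans (*P-congˡ X Φ-suc)
      (≋-trans (*P-congˡ X (X*Φ r)) (*P-distribˡ X (Φ r) (X ^ r)))))
    (≋-trans (≋-sym (+P-assoc oneP (X *P Φ r) (X ^ suc r))) (+P-cong (≋-sym Φ-suc) ≋-refl))
    where
    Φ-suc : Φ (suc r) ≋ oneP +P (X *P Φ r)
    Φ-suc = ≋-trans (∷-cong (sym (+-identityʳ 1#)) ≋-refl) (+P-cong (≋-refl {oneP}) (≋-sym (X-* (Φ r))))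

  module _ (r′ : ℕ) where
    open Quotient F[x] (Φ (suc r′))

    X^r~1 : X ^ suc r′ ~ oneP
    X^r~1 = differBy (X +P (-P oneP)) (begin
      X ^ r                                           ≈⟨ +P-identityʳ _ ⟨
      (X ^ r) +P []                                   ≈⟨ +P-cong ≋-refl (-P-inverseʳ (Φ r)) ⟨
      (X ^ r) +P (Φ r +P (-P Φ r))                    ≈⟨ +P-assoc (X ^ r) (Φ r) (-P Φ r) ⟨
      ((X ^ r) +P Φ r) +P (-P Φ r)                    ≈⟨ +P-cong (≋-trans (+P-comm (X ^ r) (Φ r)) (≋-sym (X*Φ r))) ≋-refl ⟩
      (oneP +P (X *P Φ r)) +P (-P Φ r)                ≈⟨ +P-assoc oneP (X *P Φ r) (-P Φ r) ⟩
      oneP +P ((X *P Φ r) +P (-P Φ r))                ≈⟨ +P-cong (≋-refl {oneP}) (+P-cong (*P-comm X (Φ r)) (≋-trans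
                                                           (-P-cong (≋-sym (P.*-identityʳ (Φ r)))) (-‿distribʳ-* (Φ r) oneP))) ⟩
      oneP +P ((Φ r *P X) +P (Φ r *P (-P oneP)))      ≈⟨ +P-cong (≋-refl {oneP}) (*P-distribˡ (Φ r) X (-P oneP)) ⟨
      oneP +P (Φ r *P (X +P (-P oneP)))               ∎)
      where
      r = suc r′
      open import Relation.Binary.Reasoning.Setoid P.setoid
      open import Algebra.Properties.Ring P.ring using (-‿distribʳ-*)

    -- Both representatives have degree below r′ = deg Φ_r, so the multiple of Φ_r between them is
    -- zero.
    ~⇒≋ : ∀ p q → length p ≤ r′ → length q ≤ r′ → p ~ q → p ≋ q
    ~⇒≋ p q hp hq (differBy g eq) = ≋-trans eq (≋-trans (+P-cong (≋-refl {q}) vanishes) (+P-identityʳ q))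
      where
      open import Relation.Binary.Reasoning.Setoid setoid
      vanishes : Φ (suc r′) *P g ≋ []
      vanishes = ≋-trans (*P-congˡ (Φ (suc r′)) (Φ-multiple-zero r′ g λ n r′≤n → begin
        coeff (Φ (suc r′) *P g) n                  ≈⟨ +-identityˡ _ ⟨
        0# + coeff (Φ (suc r′) *P g) n             ≈⟨ +-congʳ (coeff-beyond q (ℕₚ.≤-trans hq r′≤n)) ⟨
        coeff q n + coeff (Φ (suc r′) *P g) n      ≈⟨ coeff-+ q (Φ (suc r′) *P g) n ⟨
        coeff (q +P (Φ (suc r′) *P g)) n           ≈⟨ at eq n ⟨
        coeff p n                                  ≈⟨ coeff-beyond p (ℕₚ.≤-trans hp r′≤n) ⟩
        0#                                         ∎)) (*P-zeroʳ (Φ (suc r′)))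

-- Lowest-order expansions of polynomials with nonzero constant term.

module Expansions (F : CommutativeRing 0ℓ 0ℓ) {q : ℕ} (F-finite : IsFiniteFieldOfSize F q) where
  open CommutativeRing F
  open Poly F
  open PolynomialRing F
  open FiniteField F F-finite
  open Polynomials F
  private module P = CommutativeRing F[x]
  open import Algebra.Properties.CommutativeSemiring.Exp P.commutativeSemiring
  open SemiringMult semiring using () renaming (_×_ to _·_)
  open VectorProduct F[x]
  open import Algebra.Properties.Group P.+-group using (x∙y⁻¹≈ε⇒x≈y)
  open import Algebra.Properties.Ring P.ring using () renaming (-‿distribʳ-* to -P-distribʳ-*)

  -- p = c (1 + t x^k + O(x^(k+1))) with c ≠ 0
  record Expansion (k : ℕ) (p : Pol) (t : Carrier) : Set where
    constructor expansion
    field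
      constant : Carrier
      constant≉0 : ¬ (constant ≈ 0#)
      rest : Pol
      equality : p ≋ C constant +P ((X ^ k) *P (C (constant * t) +P (X *P rest)))

  expansion-resp : ∀ {k p p′ t t′} → p ≋ p′ → t ≈ t′ → Expansion k p t → Expansion k p′ t′
  expansion-resp {k} h h′ (expansion c c≉0 g eq) = expansion c c≉0 g (≋-trans (≋-sym h)
    (≋-trans eq (+P-cong (≋-refl {C c}) (*P-congˡ (X ^ k) (+P-cong (C-cong (*-congˡ {c} h′)) (≋-refl {X *P g}))))))

  module _ {k : ℕ} where
    private
      constant-coeff : ∀ c y → coeff (C c +P ((X ^ suc k) *P y)) 0 ≈ c
      constant-coeff c y = trans (coeff-+ (C c) ((X ^ suc k) *P y) 0) (trans (+-congˡ (coeff-X^-*-zero k y)) (+-identityʳ c))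

      middle-coeff : ∀ c d y → coeff (C c +P ((X ^ suc k) *P (C d +P (X *P y)))) (suc k) ≈ d
      middle-coeff c d y = trans (coeff-+ (C c) ((X ^ suc k) *P (C d +P (X *P y))) (suc k)) (trans (+-identityˡ _)
        (trans (reflexive (≡.cong (coeff ((X ^ suc k) *P (C d +P (X *P y)))) (≡.sym (ℕₚ.+-identityʳ (suc k)))))
          (trans (coeff-X^-* (suc k) (C d +P (X *P y)) 0) (trans (coeff-+ (C d) (X *P y) 0)
            (trans (+-congˡ (at (X-* y) 0)) (+-identityʳ d))))))

    -- The coefficients at 0 and at suc k are c and c t. A positive order keeps the two positions
    -- apart.
    expansion-unique : ∀ {p p′ t t′} → p ≋ p′ → Expansion (suc k) p t → Expansion (suc k) p′ t′ → t ≈ t′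
    expansion-unique {p} {p′} {t} {t′} h (expansion c c≉0 g eq) (expansion c′ _ g′ eq′) =
      *-cancelˡ-nonzero c≉0 (trans ct≈c′t′ (*-congʳ (sym c≈c′)))
      where
      expansions-agree = ≋-trans (≋-sym eq) (≋-trans h eq′)
      c≈c′ : c ≈ c′
      c≈c′ = trans (sym (constant-coeff c _)) (trans (at expansions-agree 0) (constant-coeff c′ _))
      ct≈c′t′ : c * t ≈ c′ * t′
      ct≈c′t′ = trans (sym (middle-coeff c _ g)) (trans (at expansions-agree (suc k)) (middle-coeff c′ _ g′))

    expansion⇒coeff≉0 : ∀ {p t} → Expansion (suc k) p t → ¬ (coeff p 0 ≈ 0#)
    expansion⇒coeff≉0 (expansion c c≉0 g eq) h = c≉0 (trans (sym (constant-coeff c _)) (trans (sym (at eq 0)) h))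

    -- Dividing by the constant term makes t additive, like a logarithmic derivative: products add
    -- the values t, and the n-th power multiplies t by n.
    expansion-* : ∀ {p p′ t t′} → Expansion (suc k) p t → Expansion (suc k) p′ t′ → Expansion (suc k) (p *P p′) (t + t′)
    expansion-* {p} {p′} {t} {t′} (expansion c c≉0 g eq) (expansion c′ c′≉0 g′ eq′) =
      expansion (c * c′) (*-nonzero c≉0 c′≉0) g″ (≋-trans (*P-cong eq eq′) (≋-trans
        (Identities.expansion-product F[x] (C c) (C (c * t)) X (X ^ k) g (C c′) (C (c′ * t′)) g′)
        (+P-cong (≋-sym (C-* c c′)) (*P-congˡ (X ^ suc k) (+P-cong linear (≋-refl {X *P g″}))))))
      where
      module FS = SemiringSolver commutativeSemiring
      g″ = ((g *P C c′) +P (C c *P g′)) +P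
           ((X ^ k) *P ((C (c * t) +P (X *P g)) *P (C (c′ * t′) +P (X *P g′))))
      linear : (C c *P C (c′ * t′)) +P (C (c * t) *P C c′) ≋ C ((c * c′) * (t + t′))
      linear = ≋-trans (+P-cong (≋-sym (C-* c (c′ * t′))) (≋-sym (C-* (c * t) c′)))
        (C-cong (FS.solve 4 (λ c t c′ t′ → c FS.:* (c′ FS.:* t′) FS.:+ (c FS.:* t) FS.:* c′ FS.:=
          (c FS.:* c′) FS.:* (t FS.:+ t′)) refl c t c′ t′))

    private
      zeroth : ∀ {c} → C c ≋ C c +P ((X ^ suc k) *P (C (c * 0#) +P (X *P [])))
      zeroth {c} = ≋-trans (≋-sym (+P-identityʳ (C c))) (+P-cong (≋-refl {C c}) (≋-sym
        (≋-trans (*P-congˡ (X ^ suc k) (≋-trans (+P-cong (≋-trans (C-cong (zeroʳ c)) C-zero) (*P-zeroʳ X)) ≋-refl))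
          (*P-zeroʳ (X ^ suc k)))))

    expansion-one : Expansion (suc k) oneP 0#
    expansion-one = expansion 1# 1≉0 [] zeroth

    expansion-^ : ∀ {p t} n → Expansion (suc k) p t → Expansion (suc k) (p ^ n) (n · t)
    expansion-^ zero    h = expansion-one
    expansion-^ (suc n) h = expansion-* h (expansion-^ n h)

    private
      n·0≈0 : ∀ n → n · 0# ≈ 0#
      n·0≈0 zero    = refl
      n·0≈0 (suc n) = trans (+-identityˡ _) (n·0≈0 n)

    expansion-∏-above : ∀ f s {n} (u : Vec ℕ n) → (∀ j → s ≤ j → Expansion (suc k) (f j) 0#) →
      Expansion (suc k) (∏ f s u) 0#
    expansion-∏-above f s []       h = expansion-one
    expansion-∏-above f s (u ∷ us) h = expansion-resp ≋-refl (trans (+-identityʳ _) (n·0≈0 u))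
      (expansion-* (expansion-^ u (h s ℕₚ.≤-refl))
        (expansion-∏-above f (suc s) us λ j s<j → h j (ℕₚ.<⇒≤ s<j)))

    -- All factors after the first begin beyond the given order, so t sees the first exponent only.
    -- The order is not tied to the index s, because for `fg` it is 2s.
    expansion-∏ : ∀ f s {n} u (us : Vec ℕ n) {t} → Expansion (suc k) (f s) t →
      (∀ j → s < j → Expansion (suc k) (f j) 0#) → Expansion (suc k) (∏ f s (u ∷ us)) (u · t)
    expansion-∏ f s u us h h′ = expansion-resp ≋-refl (+-identityʳ _)
      (expansion-* (expansion-^ u h) (expansion-∏-above f (suc s) us h′))

    expansion-at : ∀ {c d t} → ¬ (c ≈ 0#) → c * t ≈ d → Expansion (suc k) (C c +P ((X ^ suc k) *P C d)) t
    expansion-at {c} {t = t} c≉0 ct≈d = expansion c c≉0 [] (+P-cong (≋-refl {C c}) (*P-congˡ (X ^ suc k)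
      (≋-trans (C-cong (sym ct≈d)) (≋-trans (≋-sym (+P-identityʳ (C (c * t)))) (+P-cong (≋-refl {C (c * t)}) (≋-sym (*P-zeroʳ X)))))))

    expansion-beyond : ∀ {c j} d → ¬ (c ≈ 0#) → suc k < j → Expansion (suc k) (C c +P ((X ^ j) *P C d)) 0#
    expansion-beyond {c} {j} d c≉0 k<j = expansion c c≉0 ((X ^ (j ℕ.∸ suc (suc k))) *P C d)
      (+P-cong (≋-refl {C c}) (begin
        (X ^ j) *P C d
          ≈⟨ *P-cong (^-congʳ X (≡.trans (≡.sym (ℕₚ.m+[n∸m]≡n k<j)) (≡.sym (ℕₚ.+-suc (suc k) (j ℕ.∸ suc (suc k)))))) ≋-refl ⟩
        (X ^ (suc k ℕ.+ suc (j ℕ.∸ suc (suc k)))) *P C d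
          ≈⟨ *P-cong (^-homo-* X (suc k) _) ≋-refl ⟩
        ((X ^ suc k) *P (X *P (X ^ (j ℕ.∸ suc (suc k))))) *P C d
          ≈⟨ *P-assoc (X ^ suc k) (X *P (X ^ (j ℕ.∸ suc (suc k)))) (C d) ⟩
        (X ^ suc k) *P ((X *P (X ^ (j ℕ.∸ suc (suc k)))) *P C d)
          ≈⟨ *P-congˡ (X ^ suc k) (*P-assoc X (X ^ (j ℕ.∸ suc (suc k))) (C d)) ⟩
        (X ^ suc k) *P (X *P ((X ^ (j ℕ.∸ suc (suc k))) *P C d))
          ≈⟨ *P-congˡ (X ^ suc k) (+P-cong (≋-trans (C-cong (zeroʳ c)) C-zero) ≋-refl) ⟨
        (X ^ suc k) *P (C (c * 0#) +P (X *P ((X ^ (j ℕ.∸ suc (suc k))) *P C d))) ∎))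
      where open import Relation.Binary.Reasoning.Setoid P.setoid

  -- The constant coefficient of p is a unit, so the lowest coefficient of q is zero; dropping it
  -- leaves the same situation one degree lower.
  *P-zero-cancel : ∀ p q → ¬ (coeff p 0 ≈ 0#) → p *P q ≋ [] → q ≋ []
  *P-zero-cancel p []       p₀≉0 h = ≋-refl
  *P-zero-cancel p (b ∷ bs) p₀≉0 h = pointwise λ { zero → b≈0 ; (suc n) → at bs≋0 n }
    where
    open import Relation.Binary.Reasoning.Setoid setoid
    expand : ∀ n → coeff (p *P (b ∷ bs)) n ≈ b * coeff p n + coeff (0# ∷ (p *P bs)) n
    expand n = trans (at (*P-∷ʳ p b bs) n)
      (trans (coeff-+ (scale b p) (0# ∷ (p *P bs)) n) (+-congʳ (coeff-scale b p n)))
    b≈0 : b ≈ 0#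
    b≈0 = *-cancel-zero p₀≉0 (trans (*-comm _ b)
      (trans (sym (+-identityʳ _)) (trans (sym (expand 0)) (at h 0))))
    bs≋0 : bs ≋ []
    bs≋0 = *P-zero-cancel p bs p₀≉0 (pointwise λ n → begin
      coeff (p *P bs) n                                   ≈⟨ +-identityˡ _ ⟨
      0# + coeff (p *P bs) n                              ≈⟨ +-congʳ (trans (*-congʳ b≈0) (zeroˡ _)) ⟨
      b * coeff p (suc n) + coeff (p *P bs) n             ≈⟨ expand (suc n) ⟨
      coeff (p *P (b ∷ bs)) (suc n)                       ≈⟨ at h (suc n) ⟩
      0#                                                  ∎)

  *P-cancelˡ : ∀ {k p t} → Expansion (suc k) p t → ∀ q q′ → p *P q ≋ p *P q′ → q ≋ q′
  *P-cancelˡ {p = p} h q q′ eq = x∙y⁻¹≈ε⇒x≈y q q′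
    (*P-zero-cancel p (q +P (-P q′)) (expansion⇒coeff≉0 h) (begin
      p *P (q +P (-P q′))              ≈⟨ *P-distribˡ p q (-P q′) ⟩
      (p *P q) +P (p *P (-P q′))       ≈⟨ +P-cong eq (≋-sym (-P-distribʳ-* p q′)) ⟩
      (p *P q′) +P (-P (p *P q′))      ≈⟨ -P-inverseʳ (p *P q′) ⟩
      []                               ∎))
    where open import Relation.Binary.Reasoning.Setoid P.setoid

module Differences (F : CommutativeRing 0ℓ 0ℓ) where
  open CommutativeRing F
  open SemiringSolver commutativeSemiring using (solve; _:+_; _:*_; _:=_)
  open import Relation.Binary.Reasoning.Setoid setoid

  differences-vanish : ∀ {x y x′ y′} b → x + y * b ≈ x′ + y′ * b → (x + - x′) + (y + - y′) * b ≈ 0#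
  differences-vanish {x} {y} {x′} {y′} b h = begin
    (x + - x′) + (y + - y′) * b          ≈⟨ regroup x y (- x′) (- y′) ⟩
    (x + y * b) + (- x′ + - y′ * b)      ≈⟨ +-congʳ h ⟩
    (x′ + y′ * b) + (- x′ + - y′ * b)    ≈⟨ regroup x′ y′ (- x′) (- y′) ⟨
    (x′ + - x′) + (y′ + - y′) * b        ≈⟨ +-cong (-‿inverseʳ x′) (trans (*-congʳ (-‿inverseʳ y′)) (zeroˡ b)) ⟩
    0# + 0#                              ≈⟨ +-identityʳ 0# ⟩
    0#                                   ∎
    where
    regroup : ∀ x y x′ y′ → (x + x′) + (y + y′) * b ≈ (x + y * b) + (x′ + y′ * b)
    regroup x y x′ y′ = solve 5 (λ x y x′ y′ b → (x :+ x′) :+ (y :+ y′) :* b := (x :+ y :* b) :+ (x′ :+ y′ :* b)) refl x y x′ y′ b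

-- Recovering the exponents from products in F[x].

module UniqueExponents (F : CommutativeRing 0ℓ 0ℓ) {q : ℕ} (F-finite : IsFiniteFieldOfSize F q)
    {p k : ℕ} (p-prime : Prime p) (q≡p^k : q ≡ p ℕ.^ k)
    (a : CommutativeRing.Carrier F) (a≉0 : ¬ (CommutativeRing._≈_ F a (CommutativeRing.0# F))) where
  open CommutativeRing F
  open Poly F
  open PolynomialRing F
  open FiniteField F F-finite
  open Characteristic {p} {k} p-prime q≡p^k
  open Polynomials F
  open Expansions F F-finite
  private module P = CommutativeRing F[x]
  open import Algebra.Properties.CommutativeSemiring.Exp P.commutativeSemiring
  open SemiringMult semiring using (×-assoc-*; ×-congʳ) renaming (_×_ to _·_)
  open VectorProduct F[x]
  open import Algebra.Properties.Group +-group using (x∙y⁻¹≈ε⇒x≈y; inverseˡ-unique)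
  open import Algebra.Properties.Ring ring using (+-cancelʳ; +-cancelˡ; -‿distribˡ-*)

  -- The polynomial `g j` is the reciprocal x^j (x^(-j) + a) of `f j`; it is what θ^(-j) + a becomes
  -- after clearing denominators.
  f g : ℕ → Pol
  f j = (X ^ j) +P C a
  g j = oneP +P (C a *P (X ^ j))

  private
    a⁻¹ : Carrier
    a⁻¹ = proj₁ (inverse a a≉0)

    aa⁻¹≈1 : a * a⁻¹ ≈ 1#
    aa⁻¹≈1 = proj₂ (inverse a a≉0)

    f-form : ∀ j → C a +P ((X ^ j) *P C 1#) ≋ f j
    f-form j = ≋-trans (+P-comm (C a) _) (+P-cong (P.*-identityʳ (X ^ j)) (≋-refl {C a}))

    g-form : ∀ j → C 1# +P ((X ^ j) *P C a) ≋ g j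
    g-form j = +P-cong (≋-refl {oneP}) (*P-comm (X ^ j) (C a))

  -- The value arises from a + x^j = a (1 + a⁻¹ x^j); for g the constant term is 1 and the value is
  -- a.
  f-expansion-at : ∀ k → Expansion (suc k) (f (suc k)) a⁻¹
  f-expansion-at k = expansion-resp (f-form (suc k)) refl (expansion-at a≉0 aa⁻¹≈1)

  f-expansion-beyond : ∀ {k j} → suc k < j → Expansion (suc k) (f j) 0#
  f-expansion-beyond {j = j} k<j = expansion-resp (f-form j) refl (expansion-beyond 1# a≉0 k<j)

  g-expansion-at : ∀ k → Expansion (suc k) (g (suc k)) a
  g-expansion-at k = expansion-resp (g-form (suc k)) refl (expansion-at 1≉0 (*-identityˡ a))

  g-expansion-beyond : ∀ {k j} → suc k < j → Expansion (suc k) (g j) 0#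
  g-expansion-beyond {j = j} k<j = expansion-resp (g-form j) refl (expansion-beyond a 1≉0 k<j)

  ·≈·1* : ∀ n x → n · x ≈ (n · 1#) * x
  ·≈·1* n x = sym (trans (×-assoc-* n 1# x) (×-congʳ n (*-identityˡ x)))

  exponents-unique : ∀ k {n} (u v : Vec ℕ n) → All (_< p) u → All (_< p) v →
    ∏ f (suc k) u ≋ ∏ f (suc k) v → u ≡ v
  exponents-unique k []       []       _            _            _  = ≡.refl
  exponents-unique k (u ∷ us) (v ∷ vs) (u<p ∷ us<p) (v<p ∷ vs<p) eq =
    -- The leading coefficients agree as u · a⁻¹ = v · a⁻¹, which gives u = v in F only; the bound
    -- by p turns this into equality of numbers.
    cons (·1-injective u<p v<p (*-cancelˡ-nonzero a⁻¹≉0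
      (trans (commuted u) (trans (expansion-unique eq (leading u us) (leading v vs)) (sym (commuted v)))))) eq
    where
    leading : ∀ {n} u (us : Vec ℕ n) → Expansion (suc k) (∏ f (suc k) (u ∷ us)) (u · a⁻¹)
    leading u us = expansion-∏ f (suc k) u us (f-expansion-at k) (λ _ → f-expansion-beyond)
    a⁻¹≉0 : ¬ (a⁻¹ ≈ 0#)
    a⁻¹≉0 h = 1≉0 (trans (sym aa⁻¹≈1) (trans (*-congˡ h) (zeroʳ a)))
    commuted : ∀ n → a⁻¹ * (n · 1#) ≈ n · a⁻¹
    commuted n = trans (*-comm _ _) (sym (·≈·1* n a⁻¹))
    cons : ∀ {v} → u ≡ v → ∏ f (suc k) (u ∷ us) ≋ ∏ f (suc k) (v ∷ vs) → u ∷ us ≡ v ∷ vs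
    cons ≡.refl eq = ≡.cong (u ∷_) (exponents-unique (suc k) us vs us<p vs<p
      (*P-cancelˡ (expansion-^ u (f-expansion-at k)) (∏ f (suc (suc k)) us) (∏ f (suc (suc k)) vs) eq))

  module _ (a≉1 : ¬ (a ≈ 1#)) (a≉-1 : ¬ (a ≈ - 1#)) where
    private
      b : Carrier
      b = a * a

      -- (1 - a) (1 + a) = 1 - a²
      b≉1 : ¬ (b ≈ 1#)
      b≉1 b≈1 = a≉-1 (inverseˡ-unique a 1# (*-cancel-zero (λ h → a≉1 (x∙y⁻¹≈ε⇒x≈y a 1# h)) (begin
        (a + - 1#) * (a + 1#)                        ≈⟨ distribˡ _ a 1# ⟩
        (a + - 1#) * a + (a + - 1#) * 1#             ≈⟨ +-cong (distribʳ a a (- 1#)) (*-identityʳ _) ⟩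
        (b + - 1# * a) + (a + - 1#)                  ≈⟨ +-assoc b _ _ ⟩
        b + (- 1# * a + (a + - 1#))                  ≈⟨ +-congˡ (+-assoc _ a (- 1#)) ⟨
        b + ((- 1# * a + a) + - 1#)                  ≈⟨ +-congˡ (+-congʳ (trans (+-congʳ (trans (sym (-‿distribˡ-* 1# a)) (-‿cong (*-identityˡ a)))) (-‿inverseˡ a))) ⟩
        b + (0# + - 1#)                              ≈⟨ +-cong b≈1 (+-identityˡ _) ⟩
        1# + - 1#                                    ≈⟨ -‿inverseʳ 1# ⟩
        0#                                           ∎)))
        where open import Relation.Binary.Reasoning.Setoid setoid

      -- With D = x - x′ and E = y - y′ the hypotheses read D + E b = 0 = E + D b, so D = E as b ≠ 1.
      solve-system : ∀ {x y x′ y′} → x + y * b ≈ x′ + y′ * b → y + x * b ≈ y′ + x′ * b →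
        (1# + b ≈ 0# → x + y ≈ x′ + y′) → x ≈ x′ × y ≈ y′
      solve-system {x} {y} {x′} {y′} h₁ h₂ h₃ = x∙y⁻¹≈ε⇒x≈y x x′ D≈0 , x∙y⁻¹≈ε⇒x≈y y y′ (trans (sym D≈E) D≈0)
        where
        open import Relation.Binary.Reasoning.Setoid setoid
        open SemiringSolver commutativeSemiring using (solve; _:+_; _:*_; _:=_)
        D E c : Carrier
        D = x + - x′
        E = y + - y′
        c = 1# + - b
        c≉0 : ¬ (c ≈ 0#)
        c≉0 h = b≉1 (sym (x∙y⁻¹≈ε⇒x≈y 1# b h))
        D+Eb≈0 : D + E * b ≈ 0#
        D+Eb≈0 = Differences.differences-vanish F b h₁
        E+Db≈0 : E + D * b ≈ 0#
        E+Db≈0 = Differences.differences-vanish F b h₂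
        cb-split : ∀ z → c * z + z * b ≈ z
        cb-split z = begin
          c * z + z * b             ≈⟨ +-congˡ (*-comm z b) ⟩
          c * z + b * z             ≈⟨ distribʳ z c b ⟨
          (c + b) * z               ≈⟨ *-congʳ (trans (+-assoc 1# (- b) b) (trans (+-congˡ (-‿inverseˡ b)) (+-identityʳ 1#))) ⟩
          1# * z                    ≈⟨ *-identityˡ z ⟩
          z                         ∎
        D≈E : D ≈ E
        D≈E = *-cancelˡ-nonzero c≉0 (+-cancelʳ ((D + E) * b) _ _ (begin
          c * D + (D + E) * b              ≈⟨ solve 4 (λ c d e b → c :* d :+ (d :+ e) :* b := (c :* d :+ d :* b) :+ e :* b) refl c D E b ⟩
          (c * D + D * b) + E * b          ≈⟨ +-congʳ (cb-split D) ⟩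
          D + E * b                        ≈⟨ trans D+Eb≈0 (sym E+Db≈0) ⟩
          E + D * b                        ≈⟨ +-congʳ (cb-split E) ⟨
          (c * E + E * b) + D * b          ≈⟨ solve 4 (λ c d e b → (c :* e :+ e :* b) :+ d :* b := c :* e :+ (d :+ e) :* b) refl c D E b ⟩
          c * E + (D + E) * b              ∎))
        D≈0 : D ≈ 0#
        D≈0 with 1# + b ≈? 0#
        ... | no 1+b≉0 = *-cancel-zero 1+b≉0 (begin
          (1# + b) * D         ≈⟨ distribʳ D 1# b ⟩
          1# * D + b * D       ≈⟨ +-cong (*-identityˡ D) (trans (*-comm b D) (*-congʳ D≈E)) ⟩
          D + E * b            ≈⟨ D+Eb≈0 ⟩
          0#                   ∎)
        ... | yes 1+b≈0 = *-cancel-zero 2≉0 (begin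
          (1# + 1#) * D        ≈⟨ distribʳ D 1# 1# ⟩
          1# * D + 1# * D      ≈⟨ +-cong (*-identityˡ D) (trans (*-congˡ D≈E) (*-comm 1# E)) ⟩
          D + E * 1#           ≈⟨ Differences.differences-vanish F 1# (trans (+-congˡ (*-identityʳ y))
                                    (trans (h₃ 1+b≈0) (+-congˡ (sym (*-identityʳ y′))))) ⟩
          0#                   ∎)
          where
          -- In characteristic 2 the degenerate case b = -1 would be b = 1, which is excluded.
          2≉0 : ¬ (1# + 1# ≈ 0#)
          2≉0 h = b≉1 (+-cancelˡ 1# b 1# (trans 1+b≈0 (sym h)))

      -- f j * g j = a + (1 + a²) x^j + a x^(2j): for a² = -1 the middle term vanishes, and the
      -- exponents are compared at x^(2j) instead.
      fg : ℕ → Pol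
      fg j = f j *P g j

      fg-form : 1# + b ≈ 0# → ∀ j → C a +P ((X ^ (j ℕ.+ j)) *P C a) ≋ fg j
      fg-form 1+b≈0 j = ≋-sym (begin
        (Y +P A) *P (oneP +P (A *P Y))
          ≈⟨ Identities.reciprocal-product F[x] Y A oneP ⟩
        ((A *P oneP) +P ((Y *P Y) *P A)) +P (Y *P (oneP +P (A *P A)))
          ≈⟨ +P-cong (+P-cong (P.*-identityʳ A) (*P-cong (≋-sym (^-homo-* X j j)) (≋-refl {A})))
               (≋-trans (*P-congˡ Y (≋-trans (+P-cong (≋-refl {oneP}) (≋-sym (C-* a a)))
                 (≋-trans (C-cong 1+b≈0) C-zero))) (*P-zeroʳ Y)) ⟩
        (A +P ((X ^ (j ℕ.+ j)) *P A)) +P []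
          ≈⟨ +P-identityʳ _ ⟩
        A +P ((X ^ (j ℕ.+ j)) *P A) ∎)
        where
        open import Relation.Binary.Reasoning.Setoid P.setoid
        Y A : Pol
        Y = X ^ j
        A = C a

      -- Once the middle term is gone, the constant coefficient and that of x^(2j) are both a, so
      -- each factor contributes the value 1.
      fg-leading : 1# + b ≈ 0# → ∀ k {n} u (us : Vec ℕ n) →
        Expansion (suc k ℕ.+ suc k) (∏ fg (suc k) (u ∷ us)) (u · 1#)
      fg-leading 1+b≈0 k u us = expansion-∏ fg (suc k) u us
        (expansion-resp (fg-form 1+b≈0 (suc k)) refl (expansion-at a≉0 (*-identityʳ a)))
        λ j k<j → expansion-resp (fg-form 1+b≈0 j) refl (expansion-beyond a a≉0 (ℕₚ.+-mono-< k<j k<j))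

      -- Multiplying a relation by its mirror image pairs every f j with g j under the same
      -- exponent; the leading value of the result is therefore u + v.
      ∏-fg : ∀ s {n} (u v : Vec ℕ n) →
        (∏ f s u *P ∏ g s v) *P (∏ f s v *P ∏ g s u) ≋ ∏ fg s u *P ∏ fg s v
      ∏-fg s u v = ≋-trans
        (Identities.*-interchange-swap F[x] (∏ f s u) (∏ g s v) (∏ f s v) (∏ g s u))
        (*P-cong (≋-sym (∏-* f g s u)) (≋-sym (∏-* f g s v)))

      leading : ∀ k {n} u (us : Vec ℕ n) v (vs : Vec ℕ n) →
        Expansion (suc k) (∏ f (suc k) (u ∷ us) *P ∏ g (suc k) (v ∷ vs)) (u · a⁻¹ + v · a)
      leading k u us v vs = expansion-*
        (expansion-∏ f (suc k) u us (f-expansion-at k) (λ _ → f-expansion-beyond))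
        (expansion-∏ g (suc k) v vs (g-expansion-at k) (λ _ → g-expansion-beyond))

      -- Clears a⁻¹, so that the linear system has the coefficients 1 and b = a² only.
      scale-by-a : ∀ u v → a * (u · a⁻¹ + v · a) ≈ u · 1# + (v · 1#) * b
      scale-by-a u v = begin
        a * (u · a⁻¹ + v · a)                           ≈⟨ *-congˡ (+-cong (·≈·1* u a⁻¹) (·≈·1* v a)) ⟩
        a * ((u · 1#) * a⁻¹ + (v · 1#) * a)             ≈⟨ solve 4 (λ a i u v → a :* (u :* i :+ v :* a) := u :* (a :* i) :+ v :* (a :* a)) refl a a⁻¹ _ _ ⟩
        (u · 1#) * (a * a⁻¹) + (v · 1#) * b             ≈⟨ +-congʳ (trans (*-congˡ aa⁻¹≈1) (*-identityʳ _)) ⟩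
        u · 1# + (v · 1#) * b                           ∎
        where
        open import Relation.Binary.Reasoning.Setoid setoid
        open SemiringSolver commutativeSemiring using (solve; _:+_; _:*_; _:=_)

      leading-agree : ∀ k {n} u (us : Vec ℕ n) v (vs : Vec ℕ n) u′ (us′ : Vec ℕ n) v′ (vs′ : Vec ℕ n) →
        ∏ f (suc k) (u ∷ us) *P ∏ g (suc k) (v ∷ vs) ≋ ∏ f (suc k) (u′ ∷ us′) *P ∏ g (suc k) (v′ ∷ vs′) →
        u · 1# + (v · 1#) * b ≈ u′ · 1# + (v′ · 1#) * b
      leading-agree k u us v vs u′ us′ v′ vs′ eq = trans (sym (scale-by-a u v))
        (trans (*-congˡ (expansion-unique eq (leading k u us v vs) (leading k u′ us′ v′ vs′))) (scale-by-a u′ v′))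

      tails-agree : ∀ k {n} u v (us vs us′ vs′ : Vec ℕ n) →
        ∏ f (suc k) (u ∷ us) *P ∏ g (suc k) (v ∷ vs) ≋ ∏ f (suc k) (u ∷ us′) *P ∏ g (suc k) (v ∷ vs′) →
        ∏ f (suc (suc k)) us *P ∏ g (suc (suc k)) vs ≋ ∏ f (suc (suc k)) us′ *P ∏ g (suc (suc k)) vs′
      tails-agree k u v us vs us′ vs′ eq = *P-cancelˡ
        (expansion-* (expansion-^ u (f-expansion-at k)) (expansion-^ v (g-expansion-at k))) _ _
        (≋-trans (≋-sym (separate us vs)) (≋-trans eq (separate us′ vs′)))
        where
        separate : ∀ us vs → ∏ f (suc k) (u ∷ us) *P ∏ g (suc k) (v ∷ vs) ≋
          ((f (suc k) ^ u) *P (g (suc k) ^ v)) *P (∏ f (suc (suc k)) us *P ∏ g (suc (suc k)) vs)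
        separate us vs = Identities.*-interchange F[x]
          (f (suc k) ^ u) (∏ f (suc (suc k)) us) (g (suc k) ^ v) (∏ g (suc (suc k)) vs)

    -- The two relations yield u + v b and v + u b at order k + 1, and their product yields u + v
    -- when b = -1. Carrying both relations through the induction keeps the system solvable at every
    -- index.
    pair-exponents-unique : ∀ k {n} (u v u′ v′ : Vec ℕ n) →
      All (_< p) u → All (_< p) v → All (_< p) u′ → All (_< p) v′ →
      ∏ f (suc k) u *P ∏ g (suc k) v ≋ ∏ f (suc k) u′ *P ∏ g (suc k) v′ →
      ∏ f (suc k) v *P ∏ g (suc k) u ≋ ∏ f (suc k) v′ *P ∏ g (suc k) u′ →
      u ≡ u′ × v ≡ v′
    pair-exponents-unique k [] [] [] [] _ _ _ _ _ _ = ≡.refl , ≡.refl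
    pair-exponents-unique k (u ∷ us) (v ∷ vs) (u′ ∷ us′) (v′ ∷ vs′)
      (u<p ∷ us<p) (v<p ∷ vs<p) (u′<p ∷ us′<p) (v′<p ∷ vs′<p) eq eq′ =
      cons (·1-injective u<p u′<p (proj₁ heads)) (·1-injective v<p v′<p (proj₂ heads)) eq eq′
      where
      heads : u · 1# ≈ u′ · 1# × v · 1# ≈ v′ · 1#
      heads = solve-system (leading-agree k u us v vs u′ us′ v′ vs′ eq) (leading-agree k v vs u us v′ vs′ u′ us′ eq′)
        λ 1+b≈0 → expansion-unique
          (≋-trans (≋-sym (∏-fg (suc k) (u ∷ us) (v ∷ vs))) (≋-trans (*P-cong eq eq′) (∏-fg (suc k) (u′ ∷ us′) (v′ ∷ vs′))))
          (expansion-* (fg-leading 1+b≈0 k u us) (fg-leading 1+b≈0 k v vs))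
          (expansion-* (fg-leading 1+b≈0 k u′ us′) (fg-leading 1+b≈0 k v′ vs′))
      cons : ∀ {u′ v′} → u ≡ u′ → v ≡ v′ →
        ∏ f (suc k) (u ∷ us) *P ∏ g (suc k) (v ∷ vs) ≋ ∏ f (suc k) (u′ ∷ us′) *P ∏ g (suc k) (v′ ∷ vs′) →
        ∏ f (suc k) (v ∷ vs) *P ∏ g (suc k) (u ∷ us) ≋ ∏ f (suc k) (v′ ∷ vs′) *P ∏ g (suc k) (u′ ∷ us′) →
        u ∷ us ≡ u′ ∷ us′ × v ∷ vs ≡ v′ ∷ vs′
      cons ≡.refl ≡.refl eq eq′ = ≡.cong (u ∷_) (proj₁ tails) , ≡.cong (v ∷_) (proj₂ tails)
        where
        tails : us ≡ us′ × vs ≡ vs′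
        tails = pair-exponents-unique (suc k) us vs us′ vs′ us<p vs<p us′<p vs′<p
          (tails-agree k u v us vs us′ vs′ eq) (tails-agree k v u vs us vs′ us′ eq′)

-- The quotient F_q[x]/(Φ_r) and the two order bounds.

module _ where
  open import Data.Integer using (ℤ; ∣_∣; +_; -[1+_])
  open import Data.Nat using (_*_; _^_; _/_)

  module ModΦ {p q k r′ : ℕ} (p-prime : Prime p) (q≡p^k : q ≡ p ℕ.^ k)
      (r-prime : Prime (suc r′)) (q⊥r : Coprime q (suc r′)) (q-primitive : IsPrimitiveRoot q (suc r′))
      (F : CommutativeRing 0ℓ 0ℓ) (F-finite : IsFiniteFieldOfSize F q)
      (a : CommutativeRing.Carrier F) (a≉0 : ¬ (CommutativeRing._≈_ F a (CommutativeRing.0# F))) where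
    open CommutativeRing F using (_≈_; 1#; -_)
    private
      r : ℕ
      r = suc r′
      module F = CommutativeRing F
    open Poly F
    open PolynomialRing F
    open FiniteField F F-finite
    open Characteristic {p} {k} p-prime q≡p^k
    open Polynomials F
    open UniqueExponents F F-finite {p} {k} p-prime q≡p^k a a≉0
    open Quotient F[x] (Φ r)
    private
      module P = CommutativeRing F[x]
      module K = CommutativeRing R/φ
      open SemiringExp F.semiring using () renaming (_^_ to _^F_)
      module FExp = SemiringExp F.semiring
      module PExp = SemiringExp P.semiring
      open PExp using () renaming (_^_ to _^′_)
      open SemiringExp K.semiring using () renaming (_^_ to _^K_; ^-congˡ to ^K-congˡ)
      open SemiringMult F.semiring using () renaming (_×_ to _·_)
      open SemiringMult P.semiring using () renaming (_×_ to _·P_)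
      open VectorProduct F[x] using (∏)
      open VectorProduct R/φ using () renaming (∏ to ∏K)

    -- The library power is indexed by the whole ring bundle, so powers in K and in F[x] agree only
    -- propositionally.
    ^K≡^ : ∀ u n → u ^K n ≡ u ^′ n
    ^K≡^ u zero    = ≡.refl
    ^K≡^ u (suc n) = ≡.cong (u *P_) (^K≡^ u n)

    ∏K≡∏ : ∀ {f g} → (∀ j → f j ≡ g j) → ∀ s {n} (u : Vec ℕ n) → ∏K f s u ≡ ∏ g s u
    ∏K≡∏ h s []       = ≡.refl
    ∏K≡∏ {f} h s (u ∷ us) = ≡.cong₂ _*P_ (≡.trans (^K≡^ (f s) u) (≡.cong (_^′ u) (h s))) (∏K≡∏ h (suc s) us)

    C-^ : ∀ c n → C c ^′ n ≋ C (c ^F n)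
    C-^ c zero    = ≋-refl
    C-^ c (suc n) = ≋-trans (*P-congˡ (C c) (C-^ c n)) (≋-sym (C-* c (c ^F n)))

    p·1≋0 : p ·P oneP ≋ []
    p·1≋0 = ≋-trans (C-· p) (≋-trans (C-cong p·1≈0) C-zero)
      where
      C-· : ∀ n → n ·P oneP ≋ C (n · 1#)
      C-· zero    = ≋-sym C-zero
      C-· (suc n) = +P-cong (≋-refl {oneP}) (C-· n)

    fermat-iterate : ∀ n → a ^F (q ℕ.^ n) ≈ a
    fermat-iterate zero    = F.*-identityʳ a
    fermat-iterate (suc n) = F.trans (F.sym (FExp.^-assocʳ a q (q ℕ.^ n)))
      (F.trans (FExp.^-congˡ (q ℕ.^ n) (fermat-nonzero a≉0)) (fermat-iterate n))

    -- Additivity holds because q^n = p^(k n) is a power of the characteristic, and the constant a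
    -- is fixed by Fermat's theorem in F.
    frobenius-q : ∀ z n → (z +P C a) ^′ (q ℕ.^ n) ≋ (z ^′ (q ℕ.^ n)) +P C a
    frobenius-q z n = ≋-trans
      (≡.subst (λ m → (z +P C a) ^′ m ≋ (z ^′ m) +P (C a ^′ m)) (≡.sym q^n≡p^[k*n])
        (Frobenius.frobenius-iterate F[x] p-prime p·1≋0 (k ℕ.* n) z (C a)))
      (+P-cong (≋-refl {z ^′ (q ℕ.^ n)}) (≋-trans (C-^ a (q ℕ.^ n)) (C-cong (fermat-iterate n))))
      where
      q^n≡p^[k*n] : q ℕ.^ n ≡ p ℕ.^ (k ℕ.* n)
      q^n≡p^[k*n] = ≡.trans (≡.cong (ℕ._^ n) q≡p^k) (ℕₚ.^-*-assoc p k n)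

    frobenius-K : ∀ z n → ((z +P C a) ^K (q ℕ.^ n)) ~ ((z ^K (q ℕ.^ n)) +P C a)
    frobenius-K z n rewrite ^K≡^ (z +P C a) (q ℕ.^ n) | ^K≡^ z (q ℕ.^ n) = ≈⇒~ (frobenius-q z n)

    X^r~1-K : (X ^K r) ~ oneP
    X^r~1-K rewrite ^K≡^ X r = X^r~1 r′

    open PrimitiveRoot r-prime q⊥r q-primitive using (power-multiple)
    open Orbit r-prime q⊥r q-primitive R/φ (C a) frobenius-K

    modΦ⇒~ : ∀ u v → u ≡ v [modΦ r ] → u ~ v
    modΦ⇒~ u v (g , eq) = differBy g (begin
      u                           ≈⟨ +P-identityʳ u ⟨
      u +P []                     ≈⟨ +P-cong (≋-refl {u}) (-P-inverseˡ v) ⟨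
      u +P ((-P v) +P v)          ≈⟨ +P-assoc u (-P v) v ⟨
      (u +P (-P v)) +P v          ≈⟨ +P-cong (≈P⇒≋ _ _ eq) (≋-refl {v}) ⟩
      (Φ r *P g) +P v             ≈⟨ +P-comm (Φ r *P g) v ⟩
      v +P (Φ r *P g)             ∎)
      where open import Relation.Binary.Reasoning.Setoid P.setoid

    0<r′ : 0 < r′
    0<r′ = ℕ.s≤s⁻¹ (ℕ.nonTrivial⇒n>1 r {{prime⇒nonTrivial r-prime}})

    -- For a negative exponent -(n + 1) the witness r′ (n + 1) is congruent to it modulo r, since r′
    -- ≡ -1; coprimality with r thus survives as non-divisibility by r.
    θ^-natural : ∀ e → ∃ λ e′ → (θ^ r e ≋ X ^′ e′) × (Coprime ∣ e ∣ r → r ∤ e′)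
    θ^-natural (+ n)    = n , xPow≋X^ n , coprime⇒∤ r-prime
    θ^-natural -[1+ n ] = r′ * suc n , ≋-trans (≋-trans (P.reflexive (^P≡^ (xPow r′) (suc n)))
        (PExp.^-congˡ (suc n) (xPow≋X^ r′))) (PExp.^-assocʳ X r′ (suc n)) ,
      λ coprime → prime∤* r-prime (λ r∣r′ → ℕₚ.<⇒≱ (ℕₚ.n<1+n r′) (∣⇒≤ {{ℕ.>-nonZero 0<r′}} r∣r′))
        (coprime⇒∤ r-prime coprime)

    normalise-elt : ∀ e f → Coprime ∣ f ∣ r → ∀ K → (elt r e f a ^P K) ≡ oneP [modΦ r ] →
      ∃ λ w → (twisted w X ^K K) ~ oneP
    normalise-elt e f f⊥r K h with θ^-natural e | θ^-natural f
    ... | e′ , e-eq , _ | f′ , f-eq , r∤f′ with power-multiple (r∤f′ f⊥r) (prime∤1 r-prime)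
    ...   | n , eq = e′ * q ℕ.^ n , normalise X^r~1-K e′ f′ n {K} eq
      (~-trans (^K-congˡ K (≈⇒~ (≋-sym (≋-trans (*P-cong e-eq (+P-cong f-eq (≋-refl {C a})))
          (P.reflexive (≡.cong₂ (λ x y → x *P (y +P C a)) (≡.sym (^K≡^ X e′)) (≡.sym (^K≡^ X f′))))))))
        (≡.subst (_~ oneP) (≡.trans (^P≡^ (elt r e f a) K) (≡.sym (^K≡^ (elt r e f a) K))) (modΦ⇒~ _ _ h)))

    length-f : ∀ j → length (f j) ≤ suc j
    length-f j = length-+P-≤ (X ^′ j) (C a) (length-X^ j) (s≤s z≤n)

    length-g : ∀ j → length (g j) ≤ suc j
    length-g j = length-+P-≤ oneP (C a *P (X ^′ j)) (s≤s z≤n) (length-*P (C a) (X ^′ j) (s≤s z≤n) (length-X^ j))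

    f-K : ∀ j → (X ^K j) +P C a ≡ f j
    f-K j = ≡.cong (_+P C a) (^K≡^ X j)

    g-K : ∀ j → oneP +P (C a *P (X ^K j)) ≡ g j
    g-K j = ≡.cong (λ x → oneP +P (C a *P x)) (^K≡^ X j)

    entries<p : ∀ {n} {u : Vec ℕ n} → All (_≤ p ∸ 1) u → All (_< p) u
    entries<p = All.map λ u≤ → ≡.subst (suc _ ≤_) (ℕₚ.suc-pred p {{prime⇒nonZero p-prime}}) (s≤s u≤)

    -- Degree r - 2 - n means at most r′ coefficients, as reduction modulo Φ_r requires; n = 0
    -- serves (a) and n = 1 serves (b).
    suc[r∸2+n]≤r′ : ∀ n → suc (r ∸ (2 ℕ.+ n)) ≤ r′
    suc[r∸2+n]≤r′ n = ≡.subst (suc (r′ ∸ suc n) ≤_) (ℕₚ.suc-pred r′ {{ℕ.>-nonZero 0<r′}})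
      (s≤s (≡.subst (_≤ ℕ.pred r′) (ℕₚ.∸-+-assoc r′ 1 n) (ℕₚ.m∸n≤m (r′ ∸ 1) n)))

    module _ (e f₀ : ℤ) (f⊥r : Coprime ∣ f₀ ∣ r) (K : ℕ) (1≤K : 1 ≤ K)
             (h : (elt r e f₀ a ^P K) ≡ oneP [modΦ r ]) where
      private
        instance
          K-nonZero : ℕ.NonZero K
          K-nonZero = ℕ.>-nonZero 1≤K

        w : ℕ
        w = proj₁ (normalise-elt e f₀ f⊥r K h)

        power~1 : (twisted w X ^K K) ~ oneP
        power~1 = proj₂ (normalise-elt e f₀ f⊥r K h)

        residue-mod : ∀ i j → fromℕ< (m%n<n i K) ≡ fromℕ< (m%n<n j K) → i ≡ j [mod K ]
        residue-mod i j eq = %-≡⇒mod (Finₚ.fromℕ<-injective _ _ (m%n<n i K) (m%n<n j K) eq)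

      order-bound : U (r ∸ 2) (p ∸ 1) ≤ K
      order-bound = U≤ (λ u → fromℕ< (m%n<n (exponent u) K)) injective
        where
        injective : ∀ {u v} → IsPartition (r ∸ 2) (p ∸ 1) u → IsPartition (r ∸ 2) (p ∸ 1) v →
          fromℕ< (m%n<n (exponent u) K) ≡ fromℕ< (m%n<n (exponent v) K) → u ≡ v
        injective {u} {v} (wu , u≤) (wv , v≤) eq = exponents-unique 0 u v (entries<p u≤) (entries<p v≤)
          (~⇒≋ r′ (∏ f 1 u) (∏ f 1 v) (short u wu) (short v wv)
            (≡.subst₂ _~_ (∏K≡∏ f-K 1 u) (∏K≡∏ f-K 1 v)
              (products-agree X^r~1-K w {K} power~1 (s≤s (ℕₚ.m∸n≤m r′ 1)) u v wu wv
                (residue-mod (exponent u) (exponent v) eq))))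
          where
          short : ∀ u → weightedFrom 1 u ≡ r ∸ 2 → length (∏ f 1 u) ≤ r′
          short u wu = ℕₚ.≤-trans (length-∏ f length-f 1 u)
            (≡.subst (λ m → suc m ≤ r′) (≡.sym wu) (suc[r∸2+n]≤r′ 0))

      order-bound-squared : ¬ (a ≈ 1#) → ¬ (a ≈ - 1#) → U ((r ∸ 3) / 2) (p ∸ 1) ^ 2 ≤ 2 * K
      order-bound-squared a≉1 a≉-1 = ℕₚ.≤-trans
        (≡.subst (_≤ K) (≡.cong (U m (p ∸ 1) *_) (≡.sym (ℕₚ.*-identityʳ (U m (p ∸ 1)))))
          (U*U≤ (λ u v → fromℕ< (m%n<n (E u v) K)) injective))
        -- The injection bounds the square by K itself; doubling K brings it to the stated form.
        (ℕₚ.m≤n*m K 2)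
        where
        m : ℕ
        m = (r ∸ 3) / 2
        E : Vec ℕ m → Vec ℕ m → ℕ
        E = pairExponent X^r~1-K w {K} power~1 0<r′
        m+m≤r∸3 : m ℕ.+ m ≤ r ∸ 3
        m+m≤r∸3 = ≡.subst (_≤ r ∸ 3) (≡.trans (ℕₚ.*-comm m 2) (≡.cong (m ℕ.+_) (ℕₚ.+-identityʳ m))) (m/n*n≤m (r ∸ 3) 2)
        m<r : m < r
        m<r = s≤s (ℕₚ.≤-trans (m/n≤m (r ∸ 3) 2) (ℕₚ.m∸n≤m r′ 2))
        short : ∀ u v → weightedFrom 1 u ≡ m → weightedFrom 1 v ≡ m → length (∏ f 1 u *P ∏ g 1 v) ≤ r′
        short u v wu wv = ℕₚ.≤-trans
          (length-*P (∏ f 1 u) (∏ g 1 v) (length-∏ f length-f 1 u) (length-∏ g length-g 1 v))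
          (≡.subst₂ (λ i j → suc (i ℕ.+ j) ≤ r′) (≡.sym wu) (≡.sym wv)
            (ℕₚ.≤-trans (s≤s m+m≤r∸3) (suc[r∸2+n]≤r′ 1)))
        lift : ∀ (u v u′ v′ : Vec ℕ m) → weightedFrom 1 u ≡ m → weightedFrom 1 v ≡ m →
          weightedFrom 1 u′ ≡ m → weightedFrom 1 v′ ≡ m →
          (∏K (λ j → (X ^K j) +P C a) 1 u *P ∏K (λ j → oneP +P (C a *P (X ^K j))) 1 v) ~
          (∏K (λ j → (X ^K j) +P C a) 1 u′ *P ∏K (λ j → oneP +P (C a *P (X ^K j))) 1 v′) →
          ∏ f 1 u *P ∏ g 1 v ≋ ∏ f 1 u′ *P ∏ g 1 v′
        lift u v u′ v′ wu wv wu′ wv′ h = ~⇒≋ r′ _ _ (short u v wu wv) (short u′ v′ wu′ wv′)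
          (≡.subst₂ _~_ (≡.cong₂ _*P_ (∏K≡∏ f-K 1 u) (∏K≡∏ g-K 1 v)) (≡.cong₂ _*P_ (∏K≡∏ f-K 1 u′) (∏K≡∏ g-K 1 v′)) h)
        injective : ∀ {u v u′ v′} → IsPartition m (p ∸ 1) u → IsPartition m (p ∸ 1) v →
          IsPartition m (p ∸ 1) u′ → IsPartition m (p ∸ 1) v′ →
          fromℕ< (m%n<n (E u v) K) ≡ fromℕ< (m%n<n (E u′ v′) K) → u ≡ u′ × v ≡ v′
        injective {u} {v} {u′} {v′} (wu , u≤) (wv , v≤) (wu′ , u′≤) (wv′ , v′≤) eq =
          pair-exponents-unique a≉1 a≉-1 0 u v u′ v′ (entries<p u≤) (entries<p v≤) (entries<p u′≤) (entries<p v′≤)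
            (lift u v u′ v′ wu wv wu′ wv′ (proj₁ agree))
            (lift v u v′ u′ wv wu wv′ wu′ (proj₂ agree))
          where
          agree = pair-products-agree X^r~1-K w {K} power~1 0<r′ m<r u v u′ v′ wu wv wu′ wv′
            (residue-mod (E u v) (E u′ v′) eq)

open import Data.Integer using (ℤ; ∣_∣)
open import Data.Nat using (_*_; _^_; _/_)

theorem1 : (p q r : ℕ) → Prime p → Σ ℕ (λ k → q ≡ p ^ k) →
    Prime r → ¬ (r ≡ 2) → Coprime q r → IsPrimitiveRoot q r →
    (F : CommutativeRing 0ℓ 0ℓ) → IsFiniteFieldOfSize F q →
    (e f : ℤ) → Coprime ∣ f ∣ r →
    (a : CommutativeRing.Carrier F) → ¬ (CommutativeRing._≈_ F a (CommutativeRing.0# F)) →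
    Poly.OrderAtLeast F r (Poly.elt F r e f a) (U (r ∸ 2) (p ∸ 1))
    × ((¬ (CommutativeRing._≈_ F a (CommutativeRing.1# F)) →
    ¬ (CommutativeRing._≈_ F a (CommutativeRing.-_ F (CommutativeRing.1# F))) →
    (k : ℕ) → 1 ≤ k →
    Poly._≡_[modΦ_] F (Poly._^P_ F (Poly.elt F r e f a) k) (Poly.oneP F) r →
    U ((r ∸ 3) / 2) (p ∸ 1) ^ 2 ≤ 2 * k))
theorem1 p q zero _ _ r-prime = contradiction r-prime ¬prime[0]
theorem1 p q (suc r′) p-prime (n , q≡p^n) r-prime _ q⊥r q-primitive F F-finite e f f⊥r a a≉0 =
  (λ k 1≤k h → order-bound e f f⊥r k 1≤k h) ,
  (λ a≉1 a≉-1 k 1≤k h → order-bound-squared e f f⊥r k 1≤k h a≉1 a≉-1)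
  where open ModΦ {k = n} p-prime q≡p^n r-prime q⊥r q-primitive F F-finite a a≉0
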